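{- Let $n,s$ be integers with $s\geq 2$ and $s\leq \frac{n}{2^{17}\log n}$. Let $\mathcal{F}\subset \Sigma_n$ be a family of permutations such that $\nu(\mathcal{F})<s$. Then $|\mathcal{F}|\leq (s-1)(n-1)!$. Moreover, in the case of equality, $\mathcal{F}$ is of the form $\bigcup_{i=1}^{s-1}\Sigma_n[(x,y_i)]$ or $\bigcup_{i=1}^{s-1}\Sigma_n[(x_i,y)]$, where the $y_i$'s, respectively the $x_i$'s, are distinct elements of $[n]$ (and $x$, respectively $y$, is some element of $[n]$).
   Context: $\Sigma_n$ denotes the set of all permutations $[n]\to[n]$. A permutation $\sigma$ is identified with its graph $\{(i,\sigma(i)):i\in[n]\}\subset[n]^2$; two permutations intersect iff they agree at some point. $\nu(\mathcal{F})$ is the maximum number of pairwise disjoint (non-intersecting) permutations in $\mathcal{F}$. For a pair $(x,y)\in[n]^2$, $\Sigma_n[(x,y)]$ is the set of permutations $\pi\in\Sigma_n$ with $\pi(x)=y$. -}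

module Defs where

open import Algebra.Definitions.RawSemiring using () renaming (_^_ to pow)
open import Data.Fin.Base using (Fin)
open import Data.Fin.Permutation using (Permutation′; _⟨$⟩ʳ_; _≈_)
open import Data.Fin.Properties using (_≟_; any?)
open import Data.Integer.Base using (+_)
open import Data.List.Base using (List; []; _∷_; _++_; map; filter; length)
open import Data.List.Extrema.Nat using (max)
open import Data.List.Relation.Unary.AllPairs using (AllPairs; allPairs?)
open import Data.Nat.Base as ℕ using (ℕ; zero; suc; _∸_; NonZero; NonTrivial; nonTrivial⇒nonZero)
open import Data.Product.Base using (∃-syntax)
open import Data.Rational.Base as ℚ using (ℚ; 0ℚ; _/_; +-*-rawSemiring)
open import Level using (0ℓ)
open import Relation.Binary.Bundles using (Setoid)
open import Relation.Binary.PropositionalEquality using (_≡_; refl; sym; trans)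
open import Relation.Nullary using (¬_; Dec; ¬?)
open import Relation.Unary using (Pred)
import Data.List.Membership.Setoid as Membership
import Data.List.Relation.Unary.Unique.Setoid as Uniqueness

-- The natural logarithm is given by the series
--   log n = - log (1 - (n - 1) / n) = Σ_{k ≥ 1} ((n - 1) / n)ᵏ / k,
-- whose terms are positive for n ≥ 2, so that log n is the supremum of the
-- partial sums  logSum n m = Σ_{k = 1}^{m} ((n - 1) / n)ᵏ / k.
logSum : (n : ℕ) .{{_ : NonZero n}} → ℕ → ℚ
logSum n zero    = 0ℚ
logSum n (suc m) = logSum n m ℚ.+ pow +-*-rawSemiring (+ (n ∸ 1) / n) (suc m) ℚ.* (+ 1 / suc m)

infix 4 _≤_/[_·log_]

-- s ≤ a / (c · log n), that is, s · c · log n ≤ a.  As s · c ≥ 0 and log n is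
-- the supremum of its partial sums, it suffices to bound each of these.
-- For n ≥ 2 and c ≠ 0 the denominator c · log n is positive.
_≤_/[_·log_] : (s a c n : ℕ) .{{_ : NonZero c}} .{{_ : NonTrivial n}} → Set
s ≤ a /[ c ·log n ] = ∀ m → (+ (s ℕ.* c) / 1) ℚ.* logSum n {{nonTrivial⇒nonZero n}} m ℚ.≤ + a / 1

permSetoid : ℕ → Setoid 0ℓ 0ℓ
permSetoid n = record
  { Carrier       = Permutation′ n
  ; _≈_           = _≈_
  ; isEquivalence = record
    { refl  = λ _ → refl
    ; sym   = λ p i → sym (p i)
    ; trans = λ p q i → trans (p i) (q i)
    }
  }

-- A family (set) of permutations of [n], listed without repetition; equality
-- of permutations is pointwise.
record Family (n : ℕ) : Set where
  field
    members : List (Permutation′ n)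
    unique  : Uniqueness.Unique (permSetoid n) members

open Family public

infix 4 _∈_

_∈_ : ∀ {n} → Permutation′ n → Family n → Set
_∈_ {n} π F = Membership._∈_ (permSetoid n) π (members F)

∣_∣ : ∀ {n} → Family n → ℕ
∣ F ∣ = length (members F)

Intersect : ∀ {n} → Permutation′ n → Permutation′ n → Set
Intersect σ τ = ∃[ i ] σ ⟨$⟩ʳ i ≡ τ ⟨$⟩ʳ i

Disjoint : ∀ {n} → Permutation′ n → Permutation′ n → Set
Disjoint σ τ = ¬ Intersect σ τ

disjoint? : ∀ {n} (σ τ : Permutation′ n) → Dec (Disjoint σ τ)
disjoint? σ τ = ¬? (any? λ i → (σ ⟨$⟩ʳ i) ≟ (τ ⟨$⟩ʳ i))

-- For a list without repetition these are all its subsets, each listed once.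
sublists : ∀ {A : Set} → List A → List (List A)
sublists []       = [] ∷ []
sublists (x ∷ xs) = sublists xs ++ map (x ∷_) (sublists xs)

ν : ∀ {n} → Family n → ℕ
ν F = max 0 (map length (filter (allPairs? disjoint?) (sublists (members F))))

Σ[_,_] : ∀ {n} → Fin n → Fin n → Pred (Permutation′ n) 0ℓ
Σ[ x , y ] π = π ⟨$⟩ʳ x ≡ y

{-# OPTIONS --safe #-}
-- A Latin square of order n (n pairwise disjoint permutations) contains at most
-- s - 1 members of F.  Averaging over its translates gives the bound, and in the
-- case of equality every Latin square contains exactly k = s - 1 members of F.
--
-- Let f be the indicator function of F.  Switching an intercalate changes two rows
-- π, ρ of a Latin square into π (i j), ρ (i j) and keeps f π + f ρ.  Comparing the
-- switches of rows 0, 1 before and after a switch of rows 0, 2 shows that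
-- f (π (i j)) - f π depends only on i, j, π i and π j.  Hence f has degree one:
-- f σ = c + Σᵢ b i (σ i), and for σ ∈ F exactly n - k of the transpositions (i j)
-- lead from σ out of F.  Two disjoint ones among them would drop f from 1 to - 1,
-- so some place i is involved in at least four of them, and this forces
-- Σ[ i , σ i ] ⊆ F.  Removing this set from F lowers k by one; so F is a disjoint
-- union of k sets Σ[ x , y ], whose cells then lie in a common row or column.
module Submission where

open import Defs
open import Data.Fin.Base using (Fin)
open import Data.Nat.Base using (ℕ; _≤_; _<_; _∸_; _*_; _^_; _!; NonTrivial)
open import Data.Product.Base using (_×_; ∃)
open import Data.Sum.Base using (_⊎_)
open import Function.Definitions using (Injective)
open import Relation.Binary.PropositionalEquality using (_≡_)
open import Relation.Unary using (_≐_; ⋃)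

open import Data.Bool.Base using (if_then_else_)
open import Data.Fin.Base using (zero; suc; toℕ; fromℕ<; inject≤; splitAt; join; punchIn; punchOut)
open import Data.Fin.Patterns
open import Data.Fin.Permutation using (Permutation′; _⟨$⟩ʳ_; _⟨$⟩ˡ_; _≈_; id; flip; _∘ₚ_; permutation; transpose; insert; remove; inverseˡ; inverseʳ; insert-punchIn; punchIn-permute)
open import Data.Fin.Properties using (_≟_; any?; all?; suc-injective; toℕ-injective; toℕ-fromℕ<; toℕ-inject≤; toℕ<n; splitAt-join; join-splitAt; punchIn-injective; punchOut-injective; injective⇒≤; fromℕ<-injective; inject≤-injective)
open import Data.Integer.Base as ℤ using (ℤ; +_; 0ℤ)
import Data.Integer.Properties as ℤ
open import Data.Integer.Tactic.RingSolver using (solve-∀)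
open import Data.List.Base using (List; []; _∷_; length; filter; lookup)
open import Data.List.Extrema.Nat using (xs≤max)
open import Data.List.Membership.Propositional using () renaming (_∈_ to _∈ₗ_)
open import Data.List.Membership.Propositional.Properties using (∈-++⁺ˡ; ∈-++⁺ʳ; ∈-map⁺; ∈-filter⁺; ∈-lookup)
open import Data.List.Relation.Unary.All as All using (All; []; _∷_)
open import Data.List.Relation.Unary.All.Properties using (all-filter)
open import Data.List.Relation.Unary.AllPairs using (AllPairs; []; _∷_; allPairs?)
open import Data.List.Relation.Unary.AllPairs.Properties using (filter⁺)
open import Data.List.Relation.Unary.Any as Any using (here; there)
open import Data.List.Relation.Unary.Unique.Setoid using (Unique)
open import Data.Nat.Base using (zero; suc; _+_; z≤n; s≤s; NonZero)
open import Data.Nat.DivMod using (_mod_; _%_; %-distribˡ-+; %-distribˡ-*; m%n%n≡m%n; [m+kn]%n≡m%n; m<n⇒m%n≡m)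
open import Data.Nat.Properties as ℕ using (+-0-commutativeMonoid; +-*-semiring; _≤?_; _<?_; ≤-refl; ≤-reflexive; ≤-trans; <⇒≤; ≤∧≢⇒<; m≤m+n; m≤n+m; +-mono-≤)
import Data.Nat.Tactic.RingSolver as ℕ-Solver
open import Data.Product.Base using (_,_; proj₁; proj₂)
import Data.Rational.Base as ℚ
import Data.Rational.Properties as ℚ
open import Data.Rational.Unnormalised.Base using (mkℚᵘ) renaming (_≤_ to _≤ᵘ_; _*_ to _*ᵘ_)
import Data.Rational.Unnormalised.Properties as ℚᵘ
open import Data.Sum.Base using (inj₁; inj₂)
open import Data.Sum.Properties using (inj₁-injective; inj₂-injective)
open import Data.Vec.Base as Vec using (Vec; []; _∷_)
import Data.Vec.Functional as Vector
open import Function.Base using (_∘_)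
open import Relation.Binary.PropositionalEquality using (_≢_; refl; sym; trans; cong; cong₂; subst; subst₂; module ≡-Reasoning)
open import Relation.Nullary using (¬_; Dec; yes; no; contradiction; ¬?; does)
open import Relation.Nullary.Decidable using (dec-true; dec-false; toWitness; _→-dec_; _×-dec_; decidable-stable)
open import Algebra.Properties.CommutativeMonoid.Sum +-0-commutativeMonoid using (sum; sum-syntax; sum-cong-≗; ∑-distrib-+; ∑-comm)
open import Algebra.Properties.CommutativeMonoid.Sum ℤ.+-0-commutativeMonoid using () renaming (sum to sumℤ; sum-cong-≗ to sumℤ-cong; ∑-distrib-+ to sumℤ-+; ∑-comm to sumℤ-comm; sum-permute to sumℤ-permute)
open import Algebra.Properties.Semiring.Sum +-*-semiring using (*-distribˡ-sum; *-distribʳ-sum)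

-- Indicators and sums

-- On a single Latin square ν gives only an upper bound; the tightness of the average turns these
-- bounds into equalities, and the structural half uses nothing else about F. To exploit them one
-- needs, for every permutation π and any four places, a Latin square with first row π and
-- intercalates exactly there. Renaming columns and symbols reduces this to one square per order. A
-- cyclic table of odd order has the transversals that a prolongation needs but no intercalate, so
-- both intercalates are planted in a small subsquare.
--
-- The constants come from the end of the argument. At a permutation outside F, all transpositions
-- that lead into F meet each other; this confines the transpositions (i j) considered for a place i
-- to three values of j, hence the threshold four. If both ends of a transposition leading out of F
-- had at most three such partners, there would be at most 12 ordered pairs leading out of F,
-- against 2 (n - k): hence the room n ≥ k + 7.

ind : {A : Set} → Dec A → ℕ
ind (yes _) = 1
ind (no _)  = 0

ind-true : {A : Set} (d : Dec A) → A → ind d ≡ 1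
ind-true (yes _) _ = refl
ind-true (no ¬a) a = contradiction a ¬a

ind-false : {A : Set} (d : Dec A) → ¬ A → ind d ≡ 0
ind-false (yes a) ¬a = contradiction a ¬a
ind-false (no _)  _  = refl

ind-cong : {A B : Set} (d : Dec A) (e : Dec B) → (A → B) → (B → A) → ind d ≡ ind e
ind-cong (yes a) e f g = sym (ind-true e (f a))
ind-cong (no ¬a) e f g = sym (ind-false e (¬a ∘ g))

sum-mono : ∀ {n} {f g : Fin n → ℕ} → (∀ i → f i ≤ g i) → sum f ≤ sum g
sum-mono {zero}  f≤g = z≤n
sum-mono {suc n} f≤g = +-mono-≤ (f≤g zero) (sum-mono (f≤g ∘ suc))

sum-const : ∀ n k → ∑[ _ < n ] k ≡ n * k
sum-const zero    k = refl
sum-const (suc n) k = cong (_+_ k) (sum-const n k)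

sum-zero : ∀ {n} {f : Fin n → ℕ} → (∀ i → f i ≡ 0) → sum f ≡ 0
sum-zero {zero}  f≡0 = refl
sum-zero {suc n} f≡0 = cong₂ _+_ (f≡0 zero) (sum-zero (f≡0 ∘ suc))

sum-ind-unique : ∀ {n} {P : Fin n → Set} (P? : ∀ i → Dec (P i)) i →
  P i → (∀ j → P j → j ≡ i) → sum (ind ∘ P?) ≡ 1
sum-ind-unique P? zero p u = cong₂ _+_ (ind-true (P? zero) p)
  (sum-zero λ j → ind-false (P? (suc j)) λ q → contradiction (u (suc j) q) λ ())
sum-ind-unique P? (suc i) p u = cong₂ _+_
  (ind-false (P? zero) λ q → contradiction (u zero q) λ ())
  (sum-ind-unique (P? ∘ suc) i p λ j q → suc-injective (u (suc j) q))

∑-δ : ∀ {n} (i : Fin n) → ∑[ j < n ] ind (j ≟ i) ≡ 1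
∑-δ i = sum-ind-unique (_≟ i) i refl λ _ q → q

_≈?_ : ∀ {n} (σ τ : Permutation′ n) → Dec (σ ≈ τ)
σ ≈? τ = all? λ i → (σ ⟨$⟩ʳ i) ≟ (τ ⟨$⟩ʳ i)

-- Recursion on the value at `zero` reaches every permutation once up to `≈`. That none is missed or
-- repeated is the content of `∑ₚ-δ`.
∑ₚ : ∀ n → (Permutation′ n → ℕ) → ℕ
∑ₚ zero    g = g id
∑ₚ (suc n) g = ∑[ j < suc n ] ∑ₚ n λ π → g (insert zero j π)

∑ₚ-mono : ∀ n {g h : Permutation′ n → ℕ} → (∀ σ → g σ ≤ h σ) → ∑ₚ n g ≤ ∑ₚ n h
∑ₚ-mono zero    g≤h = g≤h id
∑ₚ-mono (suc n) g≤h = sum-mono λ j → ∑ₚ-mono n λ π → g≤h (insert zero j π)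

∑ₚ-cong : ∀ n {g h : Permutation′ n → ℕ} → (∀ σ → g σ ≡ h σ) → ∑ₚ n g ≡ ∑ₚ n h
∑ₚ-cong zero    g≡h = g≡h id
∑ₚ-cong (suc n) g≡h = sum-cong-≗ λ j → ∑ₚ-cong n λ π → g≡h (insert zero j π)

∑ₚ-const : ∀ n k → ∑ₚ n (λ _ → k) ≡ n ! * k
∑ₚ-const zero    k = sym (ℕ.*-identityˡ k)
∑ₚ-const (suc n) k = begin
  ∑[ _ < suc n ] ∑ₚ n (λ _ → k) ≡⟨ sum-cong-≗ {suc n} (λ _ → ∑ₚ-const n k) ⟩
  ∑[ _ < suc n ] (n ! * k)      ≡⟨ sum-const (suc n) (n ! * k) ⟩
  suc n * (n ! * k)             ≡⟨ ℕ.*-assoc (suc n) (n !) k ⟨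
  suc n ! * k                   ∎
  where open ≡-Reasoning

∑ₚ-distrib-+ : ∀ n (g h : Permutation′ n → ℕ) → ∑ₚ n (λ σ → g σ + h σ) ≡ ∑ₚ n g + ∑ₚ n h
∑ₚ-distrib-+ zero    g h = refl
∑ₚ-distrib-+ (suc n) g h = trans
  (sum-cong-≗ λ j → ∑ₚ-distrib-+ n (g ∘ insert zero j) (h ∘ insert zero j))
  (∑-distrib-+ (λ j → ∑ₚ n (g ∘ insert zero j)) λ j → ∑ₚ n (h ∘ insert zero j))

∑ₚ-∑-comm : ∀ n {m} (g : Fin m → Permutation′ n → ℕ) →
  ∑ₚ n (λ σ → ∑[ t < m ] g t σ) ≡ ∑[ t < m ] ∑ₚ n (g t)
∑ₚ-∑-comm zero    g = refl
∑ₚ-∑-comm (suc n) g = trans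
  (sum-cong-≗ λ j → ∑ₚ-∑-comm n λ t → g t ∘ insert zero j)
  (∑-comm λ j t → ∑ₚ n (g t ∘ insert zero j))

∑ₚ-δ : ∀ n (τ : Permutation′ n) → ∑ₚ n (λ σ → ind (τ ≈? σ)) ≡ 1
∑ₚ-δ zero    τ = refl
∑ₚ-δ (suc n) τ = trans (sum-cong-≗ row) (∑-δ (τ ⟨$⟩ʳ zero))
  where
  row : ∀ j → ∑ₚ n (λ π → ind (τ ≈? insert zero j π)) ≡ ind (j ≟ (τ ⟨$⟩ʳ zero))
  row j with j ≟ (τ ⟨$⟩ʳ zero)
  ... | no j≢ = trans (∑ₚ-cong n λ π → ind-false (τ ≈? insert zero j π) λ e → j≢ (sym (e zero)))
                  (trans (∑ₚ-const n 0) (ℕ.*-zeroʳ (n !)))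
  ... | yes refl = trans (∑ₚ-cong n λ π → ind-cong (τ ≈? insert zero j π) (remove zero τ ≈? π) (to π) (from π))
                     (∑ₚ-δ n (remove zero τ))
    where
    to : ∀ π → τ ≈ insert zero j π → remove zero τ ≈ π
    to π e i = punchIn-injective j _ _ (trans (sym (punchIn-permute τ zero i))
      (trans (e (suc i)) (insert-punchIn zero j π i)))
    from : ∀ π → remove zero τ ≈ π → τ ≈ insert zero j π
    from π e zero    = refl
    from π e (suc i) = trans (punchIn-permute τ zero i)
      (trans (cong (punchIn j) (e i)) (sym (insert-punchIn zero j π i)))

-- Counting along Latin squares

perm-injective : ∀ {n} (σ : Permutation′ n) {i j} → σ ⟨$⟩ʳ i ≡ σ ⟨$⟩ʳ j → i ≡ j
perm-injective σ e = trans (sym (inverseˡ σ)) (trans (cong (σ ⟨$⟩ˡ_) e) (inverseˡ σ))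

IsLatin : ∀ {n} → (Fin n → Permutation′ n) → Set
IsLatin ℓ = ∀ {s t} → s ≢ t → Disjoint (ℓ s) (ℓ t)

filter∈sublists : {A : Set} {P : A → Set} (P? : ∀ x → Dec (P x)) (xs : List A) → filter P? xs ∈ₗ sublists xs
filter∈sublists P? []       = here refl
filter∈sublists P? (x ∷ xs) with P? x
... | yes _ = ∈-++⁺ʳ (sublists xs) (∈-map⁺ (x ∷_) (filter∈sublists P? xs))
... | no _  = ∈-++⁺ˡ (filter∈sublists P? xs)

disjoint-filter≤ν : ∀ {n} (F : Family n) {P : Permutation′ n → Set} (P? : ∀ σ → Dec (P σ)) →
  AllPairs Disjoint (filter P? (members F)) → length (filter P? (members F)) ≤ ν F
disjoint-filter≤ν F P? disj = All.lookup (xs≤max 0 _)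
  (∈-map⁺ length (∈-filter⁺ (allPairs? disjoint?) (filter∈sublists P? (members F)) disj))

sum-ind≡length-filter : {A : Set} {P : A → Set} (P? : ∀ x → Dec (P x)) (xs : List A) →
  sum (λ p → ind (P? (lookup xs p))) ≡ length (filter P? xs)
sum-ind≡length-filter P? []       = refl
sum-ind≡length-filter P? (x ∷ xs) with P? x
... | yes _ = cong suc (sum-ind≡length-filter P? xs)
... | no _  = sum-ind≡length-filter P? xs

_∈?_ : ∀ {n} (σ : Permutation′ n) (F : Family n) → Dec (σ ∈ F)
σ ∈? F = Any.any? (σ ≈?_) (members F)

∈-resp-≈ : ∀ {n} (F : Family n) (σ τ : Permutation′ n) → σ ≈ τ → σ ∈ F → τ ∈ F
∈-resp-≈ F σ τ e = Any.map λ p i → trans (sym (e i)) (p i)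

-- As the list has no repetitions, at most one position contributes. Membership in this form allows
-- the order of summation to be exchanged.
ind-∈ : ∀ {n} (F : Family n) (σ : Permutation′ n) →
  ind (σ ∈? F) ≡ sum (λ p → ind (σ ≈? lookup (members F) p))
ind-∈ {n} F σ = go (members F) (unique F)
  where
  go : ∀ xs → Unique (permSetoid n) xs → ind (Any.any? (σ ≈?_) xs) ≡ sum (λ p → ind (σ ≈? lookup xs p))
  go []       []       = refl
  go (x ∷ xs) (x∉ ∷ u) with σ ≈? x
  ... | yes e = sym (cong suc (sum-zero λ p → ind-false (σ ≈? lookup xs p)
          λ e′ → All.lookup x∉ (∈-lookup p) λ i → trans (sym (e i)) (e′ i)))
  ... | no ¬e = trans (ind-cong _ (Any.any? (σ ≈?_) xs) (λ { (here e) → contradiction e ¬e ; (there q) → q }) there) (go xs u)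

module Counting {n′} (F : Family (suc n′)) where
  private
    n = suc n′
    φ = lookup (members F)

  -- The members of F that occur as rows are pairwise disjoint. They are filtered out of
  -- `members F`, not out of ℓ, because ν is a maximum over sublists of that list.
  latin-sum≤ν : (ℓ : Fin n → Permutation′ n) → IsLatin ℓ → ∑[ t < n ] ind (ℓ t ∈? F) ≤ ν F
  latin-sum≤ν ℓ L = begin
    ∑[ t < n ] ind (ℓ t ∈? F)                                    ≡⟨ sum-cong-≗ (λ t → ind-∈ F (ℓ t)) ⟩
    ∑[ t < n ] ∑[ p < ∣ F ∣ ] ind (ℓ t ≈? φ p)                   ≡⟨ ∑-comm (λ t p → ind (ℓ t ≈? φ p)) ⟩
    ∑[ p < ∣ F ∣ ] ∑[ t < n ] ind (ℓ t ≈? φ p)                   ≡⟨ sum-cong-≗ (λ p → column (φ p)) ⟩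
    ∑[ p < ∣ F ∣ ] ind (row? (φ p))                              ≡⟨ sum-ind≡length-filter row? (members F) ⟩
    length (filter row? (members F))                             ≤⟨ disjoint-filter≤ν F row? disj ⟩
    ν F                                                          ∎
    where
    open ℕ.≤-Reasoning
    row? : ∀ σ → Dec (∃ λ t → ℓ t ≈ σ)
    row? σ = any? λ t → ℓ t ≈? σ
    column : ∀ σ → ∑[ t < n ] ind (ℓ t ≈? σ) ≡ ind (row? σ)
    column σ with row? σ
    ... | no ¬r = sum-zero λ t → ind-false (ℓ t ≈? σ) λ e → ¬r (t , e)
    ... | yes (t , e) = sum-ind-unique (λ t → ℓ t ≈? σ) t e same
      where
      same : ∀ s → ℓ s ≈ σ → s ≡ t
      same s e′ with s ≟ t
      ... | yes p = p
      ... | no s≢t = contradiction (zero , trans (e′ zero) (sym (e zero))) (L s≢t)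
    go : ∀ {xs} → All (λ σ → ∃ λ t → ℓ t ≈ σ) xs → AllPairs (λ σ τ → ¬ (σ ≈ τ)) xs → AllPairs Disjoint xs
    go []              []       = []
    go {xs = σ ∷ _} ((s , e) ∷ rs) (σ∉ ∷ u) = All.zipWith (λ {τ} → head {τ}) (rs , σ∉) ∷ go rs u
      where
      head : ∀ {τ} → (∃ λ t → ℓ t ≈ τ) × ¬ (σ ≈ τ) → Disjoint σ τ
      head ((t , e′) , σ≉τ) (i , q) with s ≟ t
      ... | yes refl = σ≉τ λ j → trans (sym (e j)) (e′ j)
      ... | no s≢t   = L s≢t (i , trans (e i) (trans q (sym (e′ i))))
    disj = go (all-filter row? (members F)) (filter⁺ row? (unique F))

  ∑ₚ-translate : (ρ : Permutation′ n) → ∑ₚ n (λ σ → ind ((ρ ∘ₚ σ) ∈? F)) ≡ ∣ F ∣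
  ∑ₚ-translate ρ = begin
    ∑ₚ n (λ σ → ind ((ρ ∘ₚ σ) ∈? F))                         ≡⟨ ∑ₚ-cong n (λ σ → ind-∈ F (ρ ∘ₚ σ)) ⟩
    ∑ₚ n (λ σ → ∑[ p < ∣ F ∣ ] ind ((ρ ∘ₚ σ) ≈? φ p))        ≡⟨ ∑ₚ-∑-comm n (λ p σ → ind ((ρ ∘ₚ σ) ≈? φ p)) ⟩
    ∑[ p < ∣ F ∣ ] ∑ₚ n (λ σ → ind ((ρ ∘ₚ σ) ≈? φ p))        ≡⟨ sum-cong-≗ (λ p → ∑ₚ-cong n λ σ → ind-cong ((ρ ∘ₚ σ) ≈? φ p) ((flip ρ ∘ₚ φ p) ≈? σ) (to p σ) (from p σ)) ⟩
    ∑[ p < ∣ F ∣ ] ∑ₚ n (λ σ → ind ((flip ρ ∘ₚ φ p) ≈? σ))   ≡⟨ sum-cong-≗ (λ p → ∑ₚ-δ n (flip ρ ∘ₚ φ p)) ⟩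
    ∑[ p < ∣ F ∣ ] 1                                         ≡⟨ sum-const ∣ F ∣ 1 ⟩
    ∣ F ∣ * 1                                                ≡⟨ ℕ.*-identityʳ ∣ F ∣ ⟩
    ∣ F ∣                                                    ∎
    where
    open ≡-Reasoning
    to : ∀ p σ → (ρ ∘ₚ σ) ≈ φ p → (flip ρ ∘ₚ φ p) ≈ σ
    to p σ e i = trans (sym (e (ρ ⟨$⟩ˡ i))) (cong (σ ⟨$⟩ʳ_) (inverseʳ ρ))
    from : ∀ p σ → (flip ρ ∘ₚ φ p) ≈ σ → (ρ ∘ₚ σ) ≈ φ p
    from p σ e i = trans (sym (e (ρ ⟨$⟩ʳ i))) (cong (φ p ⟨$⟩ʳ_) (inverseˡ ρ))

  -- In `ℓ t ∘ₚ σ` the factor σ acts last, so a translate merely renames the symbols of the square.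
  translate-latin : (ℓ : Fin n → Permutation′ n) → IsLatin ℓ → ∀ σ → IsLatin (λ t → ℓ t ∘ₚ σ)
  translate-latin ℓ L σ s≢t (i , e) = L s≢t (i , perm-injective σ e)

  ∑ₚ-latin : (ℓ : Fin n → Permutation′ n) → ∑ₚ n (λ σ → ∑[ t < n ] ind ((ℓ t ∘ₚ σ) ∈? F)) ≡ n * ∣ F ∣
  ∑ₚ-latin ℓ = trans (∑ₚ-∑-comm n λ t σ → ind ((ℓ t ∘ₚ σ) ∈? F))
    (trans (sum-cong-≗ λ t → ∑ₚ-translate (ℓ t)) (sum-const n ∣ F ∣))

  size-bound : ∀ {k} → ν F ≤ k → (ℓ : Fin n → Permutation′ n) → IsLatin ℓ → ∣ F ∣ ≤ k * n′ !
  size-bound {k} ν≤k ℓ L = ℕ.*-cancelˡ-≤ n (begin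
    n * ∣ F ∣                                            ≡⟨ ∑ₚ-latin ℓ ⟨
    ∑ₚ n (λ σ → ∑[ t < n ] ind ((ℓ t ∘ₚ σ) ∈? F))        ≤⟨ ∑ₚ-mono n (λ σ → ≤-trans (latin-sum≤ν (λ t → ℓ t ∘ₚ σ) (translate-latin ℓ L σ)) ν≤k) ⟩
    ∑ₚ n (λ _ → k)                                       ≡⟨ ∑ₚ-const n k ⟩
    n * n′ ! * k                                         ≡⟨ trans (ℕ.*-assoc n (n′ !) k) (cong (n *_) (ℕ.*-comm (n′ !) k)) ⟩
    n * (k * n′ !)                                       ∎)
    where open ℕ.≤-Reasoning

  -- If the sum over ℓ fell short of k, so would the average over the translates of ℓ.
  extremal⇒balanced : ∀ {k} → ν F ≤ k → ∣ F ∣ ≡ k * n′ ! → (ℓ : Fin n → Permutation′ n) → IsLatin ℓ →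
    ∑[ t < n ] ind (ℓ t ∈? F) ≡ k
  extremal⇒balanced {k} ν≤k ∣F∣≡ ℓ L with ∑[ t < n ] ind (ℓ t ∈? F) ℕ.≟ k
  ... | yes e = e
  ... | no ≢k = contradiction (begin
    suc (n * ∣ F ∣)                                                          ≡⟨ ℕ.+-comm 1 (n * ∣ F ∣) ⟩
    n * ∣ F ∣ + 1                                                            ≡⟨ cong₂ _+_ (∑ₚ-latin ℓ) (∑ₚ-δ n id) ⟨
    ∑ₚ n (λ σ → g σ) + ∑ₚ n (λ σ → ind (id ≈? σ))                            ≡⟨ ∑ₚ-distrib-+ n g (λ σ → ind (id ≈? σ)) ⟨
    ∑ₚ n (λ σ → g σ + ind (id ≈? σ))                                         ≤⟨ ∑ₚ-mono n slack ⟩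
    ∑ₚ n (λ _ → k)                                                           ≡⟨ ∑ₚ-const n k ⟩
    n * n′ ! * k                                                             ≡⟨ trans (ℕ.*-assoc n (n′ !) k) (cong (n *_) (trans (ℕ.*-comm (n′ !) k) (sym ∣F∣≡))) ⟩
    n * ∣ F ∣                                                                ∎) ℕ.1+n≰n
    where
    open ℕ.≤-Reasoning
    g : Permutation′ n → ℕ
    g σ = ∑[ t < n ] ind ((ℓ t ∘ₚ σ) ∈? F)
    -- The extra unit sits at the one translate known to fall short, the square itself.
    slack : ∀ σ → g σ + ind (id ≈? σ) ≤ k
    slack σ with id ≈? σ
    ... | no _  = ≤-trans (≤-reflexive (ℕ.+-identityʳ (g σ))) (≤-trans (latin-sum≤ν (λ t → ℓ t ∘ₚ σ) (translate-latin ℓ L σ)) ν≤k)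
    ... | yes e = ≤-trans (≤-reflexive (trans (ℕ.+-comm (g σ) 1) (cong suc (sym same))))
                    (≤∧≢⇒< (≤-trans (latin-sum≤ν ℓ L) ν≤k) ≢k)
      where
      same : ∑[ t < n ] ind (ℓ t ∈? F) ≡ g σ
      same = sum-cong-≗ λ t → ind-cong (ℓ t ∈? F) ((ℓ t ∘ₚ σ) ∈? F)
        (∈-resp-≈ F (ℓ t) (ℓ t ∘ₚ σ) λ i → e (ℓ t ⟨$⟩ʳ i)) (∈-resp-≈ F (ℓ t ∘ₚ σ) (ℓ t) λ i → sym (e (ℓ t ⟨$⟩ʳ i)))

-- A Latin square with two intercalates

injective⇒surjective : ∀ {n} (f : Fin n → Fin n) → Injective _≡_ _≡_ f → ∀ y → ∃ λ x → f x ≡ y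
injective⇒surjective {suc n} f inj y with any? (λ x → f x ≟ y)
... | yes r = r
... | no ¬r = contradiction (injective⇒≤ {f = λ x → punchOut (y≢f x)} (λ e → inj (punchOut-injective (y≢f _) (y≢f _) e))) ℕ.1+n≰n
  where
  y≢f : ∀ x → y ≢ f x
  y≢f x e = ¬r (x , sym e)

injective⇒perm : ∀ {n} (f : Fin n → Fin n) → Injective _≡_ _≡_ f → Permutation′ n
injective⇒perm f inj = permutation f (proj₁ ∘ surj) (proj₂ ∘ surj) λ x → inj (proj₂ (surj (f x)))
  where surj = injective⇒surjective f inj

-- Arithmetic modulo an odd number

module OddCyclic (h : ℕ) where
  m : ℕ
  m = suc (h + h)

  infixl 6 _⊕_ _⊖_

  [_] : ℕ → Fin m
  [ a ] = a mod m

  -- Modulo m the factor `h + h` is - 1, which gives subtraction without truncation.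
  _⊕_ _⊖_ : Fin m → Fin m → Fin m
  x ⊕ y = [ toℕ x + toℕ y ]
  x ⊖ y = [ toℕ x + (h + h) * toℕ y ]

  toℕ-[] : ∀ a → toℕ [ a ] ≡ a % m
  toℕ-[] a = toℕ-fromℕ< _

  []-cong : ∀ a b → a % m ≡ b % m → [ a ] ≡ [ b ]
  []-cong a b e = toℕ-injective (trans (toℕ-[] a) (trans e (sym (toℕ-[] b))))

  []-toℕ : ∀ x → [ toℕ x ] ≡ x
  []-toℕ x = toℕ-injective (trans (toℕ-[] (toℕ x)) (m<n⇒m%n≡m (toℕ<n x)))

  []-period : ∀ a k → [ a + k * m ] ≡ [ a ]
  []-period a k = []-cong (a + k * m) a ([m+kn]%n≡m%n a k m)

  []-+ : ∀ a b → [ a + toℕ [ b ] ] ≡ [ a + b ]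
  []-+ a b = []-cong (a + toℕ [ b ]) (a + b) (begin
    (a + toℕ [ b ]) % m        ≡⟨ cong (λ z → (a + z) % m) (toℕ-[] b) ⟩
    (a + b % m) % m            ≡⟨ %-distribˡ-+ a (b % m) m ⟩
    (a % m + b % m % m) % m    ≡⟨ cong (λ z → (a % m + z) % m) (m%n%n≡m%n b m) ⟩
    (a % m + b % m) % m        ≡⟨ %-distribˡ-+ a b m ⟨
    (a + b) % m                ∎)
    where open ≡-Reasoning

  []-* : ∀ a b → [ a * toℕ [ b ] ] ≡ [ a * b ]
  []-* a b = []-cong (a * toℕ [ b ]) (a * b) (begin
    (a * toℕ [ b ]) % m            ≡⟨ cong (λ z → (a * z) % m) (toℕ-[] b) ⟩
    (a * (b % m)) % m              ≡⟨ %-distribˡ-* a (b % m) m ⟩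
    ((a % m) * (b % m % m)) % m    ≡⟨ cong (λ z → ((a % m) * z) % m) (m%n%n≡m%n b m) ⟩
    ((a % m) * (b % m)) % m        ≡⟨ %-distribˡ-* a b m ⟨
    (a * b) % m                    ∎)
    where open ≡-Reasoning

  ⊕-comm : ∀ x y → x ⊕ y ≡ y ⊕ x
  ⊕-comm x y = cong [_] (ℕ.+-comm (toℕ x) (toℕ y))

  ⊕-assoc : ∀ x y z → (x ⊕ y) ⊕ z ≡ x ⊕ (y ⊕ z)
  ⊕-assoc x y z = begin
    [ toℕ (x ⊕ y) + toℕ z ]      ≡⟨ cong [_] (ℕ.+-comm (toℕ (x ⊕ y)) (toℕ z)) ⟩
    [ toℕ z + toℕ (x ⊕ y) ]      ≡⟨ []-+ (toℕ z) (toℕ x + toℕ y) ⟩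
    [ toℕ z + (toℕ x + toℕ y) ]  ≡⟨ cong [_] (trans (ℕ.+-comm (toℕ z) _) (ℕ.+-assoc (toℕ x) (toℕ y) (toℕ z))) ⟩
    [ toℕ x + (toℕ y + toℕ z) ]  ≡⟨ []-+ (toℕ x) (toℕ y + toℕ z) ⟨
    x ⊕ (y ⊕ z)                  ∎
    where open ≡-Reasoning

  ⊕-⊖ : ∀ x y → y ⊕ (x ⊖ y) ≡ x
  ⊕-⊖ x y = begin
    y ⊕ (x ⊖ y)                                  ≡⟨ []-+ (toℕ y) _ ⟩
    [ toℕ y + (toℕ x + (h + h) * toℕ y) ]        ≡⟨ cong [_] (lemma h (toℕ x) (toℕ y)) ⟩
    [ toℕ x + toℕ y * m ]                        ≡⟨ []-period (toℕ x) (toℕ y) ⟩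
    [ toℕ x ]                                    ≡⟨ []-toℕ x ⟩
    x                                            ∎
    where
    open ≡-Reasoning
    lemma : ∀ h a b → b + (a + (h + h) * b) ≡ a + b * suc (h + h)
    lemma = ℕ-Solver.solve-∀

  ⊖-⊕ : ∀ x y → (x ⊕ y) ⊖ x ≡ y
  ⊖-⊕ x y = begin
    [ toℕ (x ⊕ y) + (h + h) * toℕ x ]            ≡⟨ cong [_] (ℕ.+-comm (toℕ (x ⊕ y)) _) ⟩
    [ (h + h) * toℕ x + toℕ (x ⊕ y) ]            ≡⟨ []-+ ((h + h) * toℕ x) _ ⟩
    [ (h + h) * toℕ x + (toℕ x + toℕ y) ]        ≡⟨ cong [_] (lemma h (toℕ x) (toℕ y)) ⟩
    [ toℕ y + toℕ x * m ]                        ≡⟨ []-period (toℕ y) (toℕ x) ⟩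
    [ toℕ y ]                                    ≡⟨ []-toℕ y ⟩
    y                                            ∎
    where
    open ≡-Reasoning
    lemma : ∀ h a b → (h + h) * a + (a + b) ≡ b + a * suc (h + h)
    lemma = ℕ-Solver.solve-∀

  ⊕-cancelˡ : ∀ x {y z} → x ⊕ y ≡ x ⊕ z → y ≡ z
  ⊕-cancelˡ x {y} {z} e = trans (sym (⊖-⊕ x y)) (trans (cong (_⊖ x) e) (⊖-⊕ x z))

  ⊕-cancelʳ : ∀ x {y z} → y ⊕ x ≡ z ⊕ x → y ≡ z
  ⊕-cancelʳ x {y} {z} e = ⊕-cancelˡ x (trans (⊕-comm x y) (trans e (⊕-comm z x)))

  -- `suc h` is the inverse of 2, because 2 (h + 1) = m + 1.
  double-injective : ∀ {x y} → x ⊕ x ≡ y ⊕ y → x ≡ y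
  double-injective {x} {y} e = trans (sym (half x)) (trans (cong (λ z → [ suc h * toℕ z ]) e) (half y))
    where
    lemma : ∀ h a → suc h * (a + a) ≡ a + a * suc (h + h)
    lemma = ℕ-Solver.solve-∀
    half : ∀ x → [ suc h * toℕ (x ⊕ x) ] ≡ x
    half x = trans ([]-* (suc h) (toℕ x + toℕ x)) (trans (cong [_] (lemma h (toℕ x)))
      (trans ([]-period (toℕ x) (toℕ x)) ([]-toℕ x)))

-- The addition table of ℤ/m prolonged along the w disjoint sets c - r = d, which are
-- transversals as m is odd: their entries are moved to w new rows and columns, whose common block is filled with S.
module Prolongation (h w : ℕ) (w≤m : w ≤ suc (h + h)) (S : Fin w → Fin w → Fin w)
  (S-row : ∀ r → Injective _≡_ _≡_ (S r)) (S-col : ∀ c → Injective _≡_ _≡_ (λ r → S r c)) where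
  open OddCyclic h

  ι : Fin w → Fin m
  ι d = inject≤ d w≤m

  -- Cells with `c ⊖ r` below w lie on a moved transversal and receive its number as a new symbol.
  -- The decision is an argument, so that proofs about two cells can match on both outcomes.
  entry : (r c : Fin m) → Dec (toℕ (c ⊖ r) < w) → Fin w ⊎ Fin m
  entry r c (yes p) = inj₁ (fromℕ< p)
  entry r c (no _)  = inj₂ (r ⊕ c)

  -- `inj₁` marks new rows, columns and symbols. Transversal d meets column c in row `c ⊖ ι d` and
  -- row r in column `r ⊕ ι d`; the new row and column receive the sums that stood there in the
  -- cyclic table.
  L : Fin w ⊎ Fin m → Fin w ⊎ Fin m → Fin w ⊎ Fin m
  L (inj₁ d) (inj₁ e) = inj₁ (S d e)
  L (inj₁ d) (inj₂ c) = inj₂ (c ⊕ (c ⊖ ι d))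
  L (inj₂ r) (inj₁ d) = inj₂ (r ⊕ (r ⊕ ι d))
  L (inj₂ r) (inj₂ c) = entry r c (toℕ (c ⊖ r) <? w)

  ι-injective : ∀ {d e} → ι d ≡ ι e → d ≡ e
  ι-injective {d} {e} = inject≤-injective w≤m w≤m d e

  ι<w : ∀ {x} d → x ≡ ι d → toℕ x < w
  ι<w d refl = subst (_< w) (sym (toℕ-inject≤ d w≤m)) (toℕ<n d)

  ⊖-injectiveʳ : ∀ c {r r′} → c ⊖ r ≡ c ⊖ r′ → r ≡ r′
  ⊖-injectiveʳ c {r} {r′} e = ⊕-cancelʳ (c ⊖ r)
    (trans (⊕-⊖ c r) (sym (trans (cong (r′ ⊕_) e) (⊕-⊖ c r′))))

  ⊖-injectiveˡ : ∀ r {c c′} → c ⊖ r ≡ c′ ⊖ r → c ≡ c′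
  ⊖-injectiveˡ r {c} {c′} e = trans (sym (⊕-⊖ c r)) (trans (cong (r ⊕_) e) (⊕-⊖ c′ r))

  entry-row : ∀ r {c c′} p q → entry r c p ≡ entry r c′ q → c ≡ c′
  entry-row r (yes p) (yes q) e = ⊖-injectiveˡ r (toℕ-injective (fromℕ<-injective _ _ p q (inj₁-injective e)))
  entry-row r (no _)  (no _)  e = ⊕-cancelˡ r (inj₂-injective e)

  entry-col : ∀ c {r r′} p q → entry r c p ≡ entry r′ c q → r ≡ r′
  entry-col c (yes p) (yes q) e = ⊖-injectiveʳ c (toℕ-injective (fromℕ<-injective _ _ p q (inj₁-injective e)))
  entry-col c (no _)  (no _)  e = ⊕-cancelʳ c (inj₂-injective e)

  -- In row r this symbol stood only at column `r ⊕ ι d`, a cell of transversal d, which now holds a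
  -- new symbol.
  entry-row-new : ∀ r c d p → entry r c p ≢ inj₂ (r ⊕ (r ⊕ ι d))
  entry-row-new r c d (no ¬p) e = ¬p (ι<w d (trans (cong (_⊖ r) (⊕-cancelˡ r (inj₂-injective e))) (⊖-⊕ r (ι d))))

  entry-col-new : ∀ r c d p → entry r c p ≢ inj₂ (c ⊕ (c ⊖ ι d))
  entry-col-new r c d (no ¬p) e = ¬p (ι<w d (trans (cong (_⊖ r) c≡) (⊖-⊕ r (ι d))))
    where
    r≡ : r ≡ c ⊖ ι d
    r≡ = ⊕-cancelˡ c (trans (⊕-comm c r) (inj₂-injective e))
    c≡ : c ≡ r ⊕ ι d
    c≡ = trans (sym (⊕-⊖ c (ι d))) (trans (cong (ι d ⊕_) (sym r≡)) (⊕-comm (ι d) r))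

  L-row : ∀ r {c c′} → L r c ≡ L r c′ → c ≡ c′
  L-row (inj₁ d) {inj₁ _} {inj₁ _} e = cong inj₁ (S-row d (inj₁-injective e))
  -- With u = `c ⊖ ι d` the symbol is ι d + 2 u. Injectivity of doubling is what makes the set of
  -- cells a transversal.
  L-row (inj₁ d) {inj₂ c} {inj₂ c′} e = cong inj₂ (⊖-injectiveˡ (ι d) (double-injective (⊕-cancelˡ (ι d)
    (trans (expand c) (trans (inj₂-injective e) (sym (expand c′)))))))
    where
    expand : ∀ c → ι d ⊕ ((c ⊖ ι d) ⊕ (c ⊖ ι d)) ≡ c ⊕ (c ⊖ ι d)
    expand c = trans (sym (⊕-assoc (ι d) _ _)) (cong (_⊕ (c ⊖ ι d)) (⊕-⊖ c (ι d)))
  L-row (inj₂ r) {inj₁ _} {inj₁ _} e = cong inj₁ (ι-injective (⊕-cancelˡ r (⊕-cancelˡ r (inj₂-injective e))))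
  L-row (inj₂ r) {inj₁ d} {inj₂ c} e = contradiction (sym e) (entry-row-new r c d _)
  L-row (inj₂ r) {inj₂ c} {inj₁ d} e = contradiction e (entry-row-new r c d _)
  L-row (inj₂ r) {inj₂ _} {inj₂ _} e = cong inj₂ (entry-row r _ _ e)

  L-col : ∀ c {r r′} → L r c ≡ L r′ c → r ≡ r′
  L-col (inj₁ d) {inj₁ _} {inj₁ _} e = cong inj₁ (S-col d (inj₁-injective e))
  L-col (inj₁ d) {inj₂ r} {inj₂ r′} e = cong inj₂ (double-injective (⊕-cancelʳ (ι d)
    (trans (⊕-assoc r r (ι d)) (trans (inj₂-injective e) (sym (⊕-assoc r′ r′ (ι d)))))))
  L-col (inj₂ c) {inj₁ _} {inj₁ _} e = cong inj₁ (ι-injective (⊖-injectiveʳ c (⊕-cancelˡ c (inj₂-injective e))))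
  L-col (inj₂ c) {inj₁ d} {inj₂ r} e = contradiction (sym e) (entry-col-new r c d _)
  L-col (inj₂ c) {inj₂ r} {inj₁ d} e = contradiction e (entry-col-new r c d _)
  L-col (inj₂ c) {inj₂ _} {inj₂ _} e = cong inj₂ (entry-col c _ _ e)

  table : Fin (w + m) → Fin (w + m) → Fin (w + m)
  table r c = join w m (L (splitAt w r) (splitAt w c))

  join-injective : ∀ {x y} → join w m x ≡ join w m y → x ≡ y
  join-injective {x} {y} e = trans (sym (splitAt-join w m x)) (trans (cong (splitAt w) e) (splitAt-join w m y))

  splitAt-injective : ∀ {x y} → splitAt w {m} x ≡ splitAt w y → x ≡ y
  splitAt-injective {x} {y} e = trans (sym (join-splitAt w m x)) (trans (cong (join w m) e) (join-splitAt w m y))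

  rows : Fin (w + m) → Permutation′ (w + m)
  rows r = injective⇒perm (table r) λ e → splitAt-injective (L-row (splitAt w r) (join-injective e))

  rows-latin : IsLatin rows
  rows-latin s≢t (c , e) = s≢t (splitAt-injective (L-col (splitAt w c) (join-injective e)))

-- The planted subsquares

fromTable : ∀ {w} → Vec (Vec (Fin w) w) w → Fin w → Fin w → Fin w
fromTable T r c = Vec.lookup (Vec.lookup T r) c

-- Six is the least possible order: in columns 0 and 1 the symbols 0 and 1 are taken by rows 0 and
-- 1, while row 2 spends 2 and 3 on columns 2 and 3, so two further symbols are required.
table₆ : Vec (Vec (Fin 6) 6) 6
table₆ =
  (0F ∷ 1F ∷ 2F ∷ 3F ∷ 4F ∷ 5F ∷ []) ∷
  (1F ∷ 0F ∷ 4F ∷ 5F ∷ 2F ∷ 3F ∷ []) ∷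
  (4F ∷ 5F ∷ 3F ∷ 2F ∷ 0F ∷ 1F ∷ []) ∷
  (2F ∷ 3F ∷ 0F ∷ 1F ∷ 5F ∷ 4F ∷ []) ∷
  (3F ∷ 2F ∷ 5F ∷ 4F ∷ 1F ∷ 0F ∷ []) ∷
  (5F ∷ 4F ∷ 1F ∷ 0F ∷ 3F ∷ 2F ∷ []) ∷ []

table₇ : Vec (Vec (Fin 7) 7) 7
table₇ =
  (0F ∷ 1F ∷ 2F ∷ 3F ∷ 4F ∷ 5F ∷ 6F ∷ []) ∷
  (1F ∷ 0F ∷ 4F ∷ 5F ∷ 2F ∷ 6F ∷ 3F ∷ []) ∷
  (4F ∷ 5F ∷ 3F ∷ 2F ∷ 6F ∷ 0F ∷ 1F ∷ []) ∷
  (2F ∷ 3F ∷ 0F ∷ 6F ∷ 1F ∷ 4F ∷ 5F ∷ []) ∷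
  (3F ∷ 2F ∷ 6F ∷ 0F ∷ 5F ∷ 1F ∷ 4F ∷ []) ∷
  (5F ∷ 6F ∷ 1F ∷ 4F ∷ 0F ∷ 3F ∷ 2F ∷ []) ∷
  (6F ∷ 4F ∷ 5F ∷ 1F ∷ 3F ∷ 2F ∷ 0F ∷ []) ∷ []

injective? : ∀ {n} (f : Fin n → Fin n) → Dec (∀ x y → f x ≡ f y → x ≡ y)
injective? f = all? λ x → all? λ y → (f x ≟ f y) →-dec (x ≟ y)

-- Rows 0 and 1 meet in an intercalate on the columns 0, 1, rows 0 and 2 in one on the columns 2, 3.
record Seed (n : ℕ) : Set where
  field
    square  : Fin (4 + n) → Permutation′ (4 + n)
    latin   : IsLatin square
    01-left  : square 1F ⟨$⟩ʳ 0F ≡ square 0F ⟨$⟩ʳ 1F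
    01-right : square 1F ⟨$⟩ʳ 1F ≡ square 0F ⟨$⟩ʳ 0F
    02-left  : square 2F ⟨$⟩ʳ 2F ≡ square 0F ⟨$⟩ʳ 3F
    02-right : square 2F ⟨$⟩ʳ 3F ≡ square 0F ⟨$⟩ʳ 2F

parity : ∀ n → ∃ λ h → n ≡ h + h ⊎ n ≡ suc (h + h)
parity zero = 0 , inj₁ refl
parity (suc n) with parity n
... | h , inj₁ refl = h , inj₂ refl
... | h , inj₂ refl = suc h , inj₁ (cong suc (sym (ℕ.+-suc h h)))

-- The cyclic part must have odd order, so parity decides how the order 7 + n is split: 6 + (n + 1)
-- for even n, 7 + n for odd n. The intercalates lie in the common block of the new rows and
-- columns, where the entries are found by computation.
seed : ∀ n → 7 ≤ n → Seed (3 + n)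
seed n 7≤n with parity n
... | h , inj₁ refl = record
  { square = rows ; latin = λ {s} {t} → rows-latin {s} {t}
  ; 01-left = refl ; 01-right = refl ; 02-left = refl ; 02-right = refl }
  where
  open Prolongation h 6 (ℕ.≤-trans (ℕ.n≤1+n 6) (ℕ.≤-trans 7≤n (ℕ.n≤1+n _))) (fromTable table₆)
    (λ r e → toWitness {a? = all? λ r → injective? (fromTable table₆ r)} _ r _ _ e)
    (λ c e → toWitness {a? = all? λ c → injective? λ r → fromTable table₆ r c} _ c _ _ e)
... | h , inj₂ refl = record
  { square = rows ; latin = λ {s} {t} → rows-latin {s} {t}
  ; 01-left = refl ; 01-right = refl ; 02-left = refl ; 02-right = refl }
  where
  open Prolongation h 7 7≤n (fromTable table₇)
    (λ r e → toWitness {a? = all? λ r → injective? (fromTable table₇ r)} _ r _ _ e)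
    (λ c e → toWitness {a? = all? λ c → injective? λ r → fromTable table₇ r c} _ c _ _ e)

-- Transpositions and switching

module _ {n} (i j : Fin n) where

  transpose-left : transpose i j ⟨$⟩ʳ i ≡ j
  transpose-left rewrite dec-true (i ≟ i) refl = refl

  transpose-right : transpose i j ⟨$⟩ʳ j ≡ i
  transpose-right with j ≟ i
  ... | yes j≡i = j≡i
  ... | no _ rewrite dec-true (j ≟ j) refl = refl

  transpose-other : ∀ {q} → q ≢ i → q ≢ j → transpose i j ⟨$⟩ʳ q ≡ q
  transpose-other {q} q≢i q≢j rewrite dec-false (q ≟ i) q≢i | dec-false (q ≟ j) q≢j = refl

  -- Opaque, so that case splits on q ≟ i do not rewrite inside it.
  opaque
    sw : Permutation′ n → Permutation′ n
    sw σ = transpose i j ∘ₚ σ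

    sw-left : ∀ σ → sw σ ⟨$⟩ʳ i ≡ σ ⟨$⟩ʳ j
    sw-left σ = cong (σ ⟨$⟩ʳ_) transpose-left

    sw-right : ∀ σ → sw σ ⟨$⟩ʳ j ≡ σ ⟨$⟩ʳ i
    sw-right σ = cong (σ ⟨$⟩ʳ_) transpose-right

    sw-other : ∀ σ {q} → q ≢ i → q ≢ j → sw σ ⟨$⟩ʳ q ≡ σ ⟨$⟩ʳ q
    sw-other σ q≢i q≢j = cong (σ ⟨$⟩ʳ_) (transpose-other q≢i q≢j)

    sw-cong : ∀ {σ τ : Permutation′ n} → σ ≈ τ → sw σ ≈ sw τ
    sw-cong e q = e (transpose i j ⟨$⟩ʳ q)

  ≈-sw : ∀ σ (τ : Permutation′ n) → τ ⟨$⟩ʳ i ≡ σ ⟨$⟩ʳ j → τ ⟨$⟩ʳ j ≡ σ ⟨$⟩ʳ i →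
    (∀ q → q ≢ i → q ≢ j → τ ⟨$⟩ʳ q ≡ σ ⟨$⟩ʳ q) → τ ≈ sw σ
  ≈-sw σ τ eᵢ eⱼ e q with q ≟ i
  ... | yes refl = trans eᵢ (sym (sw-left σ))
  ... | no q≢i with q ≟ j
  ...   | yes refl = trans eⱼ (sym (sw-right σ))
  ...   | no q≢j = trans (e q q≢i q≢j) (sym (sw-other σ q≢i q≢j))

sw-diag : ∀ {n} i (σ : Permutation′ n) → σ ≈ sw i i σ
sw-diag i σ = ≈-sw i i σ σ refl refl λ _ _ _ → refl

sw-involutive : ∀ {n} i j (σ : Permutation′ n) → σ ≈ sw i j (sw i j σ)
sw-involutive i j σ = ≈-sw i j (sw i j σ) σ (sym (sw-right i j σ)) (sym (sw-left i j σ))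
  λ q q≢i q≢j → sym (sw-other i j σ q≢i q≢j)

sw-sym : ∀ {n} i j (σ : Permutation′ n) → sw j i σ ≈ sw i j σ
sw-sym i j σ = ≈-sw i j σ (sw j i σ) (sw-right j i σ) (sw-left j i σ)
  λ q q≢i q≢j → sw-other j i σ q≢j q≢i

_⟂_ : ∀ {n} (p q : Fin n × Fin n) → Set
(x , y) ⟂ (x′ , y′) = x ≢ x′ × y ≢ y′

opaque
  -- A transposition of values carries σ x to y. It fixes the values already arranged, which differ
  -- from y by hypothesis and from σ x by injectivity.
  extend : ∀ {n} (ps : List (Fin n × Fin n)) → AllPairs _⟂_ ps →
    ∃ λ (σ : Permutation′ n) → All (λ p → Σ[ proj₁ p , proj₂ p ] σ) ps
  extend []             []       = id , []
  extend ((x , y) ∷ ps) (⟂p ∷ ⟂ps) with σ , σ-ps ← extend ps ⟂ps =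
    σ ∘ₚ transpose (σ ⟨$⟩ʳ x) y ,
    transpose-left (σ ⟨$⟩ʳ x) y ∷ All.zipWith (λ { ((x≢ , y≢) , e) → trans
      (transpose-other (σ ⟨$⟩ʳ x) y (λ e′ → x≢ (perm-injective σ (sym e′))) (λ e′ → y≢ (trans (sym e′) e))) e })
      (⟂p , σ-ps)

-- Each transposition c c′ corrects the value at c without disturbing the places where σ and τ already agree.
connect : ∀ {n} (τ : Permutation′ n) (P : Permutation′ n → Set) → (∀ σ → σ ≈ τ → P σ) →
  (∀ σ c c′ → c ≢ c′ → σ ⟨$⟩ʳ c ≢ τ ⟨$⟩ʳ c → σ ⟨$⟩ʳ c′ ≢ τ ⟨$⟩ʳ c′ → P (sw c c′ σ) → P σ) →
  ∀ σ → P σ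
connect {n} τ P base step σ = go n ≤-refl σ λ i n≤i → contradiction (toℕ<n i) (ℕ.≤⇒≯ n≤i)
  where
  go : ∀ d → d ≤ n → ∀ σ → (∀ i → d ≤ toℕ i → σ ⟨$⟩ʳ i ≡ τ ⟨$⟩ʳ i) → P σ
  go zero    _   σ agree = base σ λ i → agree i z≤n
  go (suc d) d<n σ agree with (σ ⟨$⟩ʳ fromℕ< d<n) ≟ (τ ⟨$⟩ʳ fromℕ< d<n)
  ... | yes e = go d (<⇒≤ d<n) σ agree′
    where
    agree′ : ∀ i → d ≤ toℕ i → σ ⟨$⟩ʳ i ≡ τ ⟨$⟩ʳ i
    agree′ i d≤i with i ≟ fromℕ< d<n
    ... | yes refl = e
    ... | no i≢ = agree i (≤∧≢⇒< d≤i λ d≡ → i≢ (toℕ-injective (trans (sym d≡) (sym (toℕ-fromℕ< d<n)))))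
  ... | no σc≢τc = step σ c c′ c≢c′ σc≢τc σc′≢τc′ (go d (<⇒≤ d<n) (sw c c′ σ) agree′)
    where
    c c′ : Fin n
    c  = fromℕ< d<n
    c′ = σ ⟨$⟩ˡ (τ ⟨$⟩ʳ c)
    σc′≡τc : σ ⟨$⟩ʳ c′ ≡ τ ⟨$⟩ʳ c
    σc′≡τc = inverseʳ σ
    c≢c′ : c ≢ c′
    c≢c′ e = σc≢τc (trans (cong (σ ⟨$⟩ʳ_) e) σc′≡τc)
    σc′≢τc′ : σ ⟨$⟩ʳ c′ ≢ τ ⟨$⟩ʳ c′
    σc′≢τc′ e = c≢c′ (perm-injective τ (trans (sym σc′≡τc) e))
    agree′ : ∀ i → d ≤ toℕ i → sw c c′ σ ⟨$⟩ʳ i ≡ τ ⟨$⟩ʳ i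
    agree′ i d≤i with i ≟ c
    ... | yes refl = trans (sw-left c c′ σ) σc′≡τc
    ... | no i≢c = trans (sw-other c c′ σ i≢c (λ { refl → σc′≢τc′ agreeᵢ })) agreeᵢ
      where
      agreeᵢ = agree i (≤∧≢⇒< d≤i λ d≡ → i≢c (toℕ-injective (trans (sym d≡) (sym (toℕ-fromℕ< d<n)))))

Disjoint-sym : ∀ {n} (σ τ : Permutation′ n) → Disjoint σ τ → Disjoint τ σ
Disjoint-sym σ τ d (i , e) = d (i , sym e)

module Switch {m} (ℓ : Fin (2 + m) → Permutation′ (2 + m)) (L : IsLatin ℓ) (i j : Fin (2 + m))
  (eᵢ : ℓ 1F ⟨$⟩ʳ i ≡ ℓ 0F ⟨$⟩ʳ j) (eⱼ : ℓ 1F ⟨$⟩ʳ j ≡ ℓ 0F ⟨$⟩ʳ i) where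

  switched : Fin (2 + m) → Permutation′ (2 + m)
  switched 0F            = sw i j (ℓ 0F)
  switched 1F            = sw i j (ℓ 1F)
  switched (suc (suc t)) = ℓ (suc (suc t))

  -- Each column keeps its pair of symbols in rows 0 and 1, so disjointness from the other rows is
  -- inherited column by column.
  column : ∀ q →
    (switched 0F ⟨$⟩ʳ q ≡ ℓ 0F ⟨$⟩ʳ q × switched 1F ⟨$⟩ʳ q ≡ ℓ 1F ⟨$⟩ʳ q) ⊎
    (switched 0F ⟨$⟩ʳ q ≡ ℓ 1F ⟨$⟩ʳ q × switched 1F ⟨$⟩ʳ q ≡ ℓ 0F ⟨$⟩ʳ q)
  column q with q ≟ i
  ... | yes refl = inj₂ (trans (sw-left i j (ℓ 0F)) (sym eᵢ) , trans (sw-left i j (ℓ 1F)) eⱼ)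
  ... | no q≢i with q ≟ j
  ...   | yes refl = inj₂ (trans (sw-right i j (ℓ 0F)) (sym eⱼ) , trans (sw-right i j (ℓ 1F)) eᵢ)
  ...   | no q≢j = inj₁ (sw-other i j (ℓ 0F) q≢i q≢j , sw-other i j (ℓ 1F) q≢i q≢j)

  disjoint₀₁ : Disjoint (switched 0F) (switched 1F)
  disjoint₀₁ (q , e) with column q
  ... | inj₁ (e₀ , e₁) = L (λ ()) (q , trans (sym e₀) (trans e e₁))
  ... | inj₂ (e₀ , e₁) = L (λ ()) (q , trans (sym e₀) (trans e e₁))

  disjoint₀ : ∀ t → Disjoint (switched 0F) (ℓ (suc (suc t)))
  disjoint₀ t (q , e) with column q
  ... | inj₁ (e₀ , _) = L (λ ()) (q , trans (sym e₀) e)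
  ... | inj₂ (e₀ , _) = L (λ ()) (q , trans (sym e₀) e)

  disjoint₁ : ∀ t → Disjoint (switched 1F) (ℓ (suc (suc t)))
  disjoint₁ t (q , e) with column q
  ... | inj₁ (_ , e₁) = L (λ ()) (q , trans (sym e₁) e)
  ... | inj₂ (_ , e₁) = L (λ ()) (q , trans (sym e₁) e)

  switched-latin : IsLatin switched
  switched-latin {0F} {0F} s≢t = contradiction refl s≢t
  switched-latin {0F} {1F} _ = disjoint₀₁
  switched-latin {0F} {suc (suc t)} _ = disjoint₀ t
  switched-latin {1F} {0F} _ = Disjoint-sym (switched 0F) (switched 1F) disjoint₀₁
  switched-latin {1F} {1F} s≢t = contradiction refl s≢t
  switched-latin {1F} {suc (suc t)} _ = disjoint₁ t
  switched-latin {suc (suc s)} {0F} _ = Disjoint-sym (switched 0F) (ℓ (suc (suc s))) (disjoint₀ s)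
  switched-latin {suc (suc s)} {1F} _ = Disjoint-sym (switched 1F) (ℓ (suc (suc s))) (disjoint₁ s)
  switched-latin {suc (suc s)} {suc (suc t)} s≢t = L s≢t

-- `Switch` acts on rows 0 and 1; exchanging rows 1 and 2 makes it available for rows 0 and 2.
reindex-latin : ∀ {n} (ℓ : Fin n → Permutation′ n) → IsLatin ℓ → (ρ : Permutation′ n) → IsLatin (λ t → ℓ (ρ ⟨$⟩ʳ t))
reindex-latin ℓ L ρ s≢t = L (s≢t ∘ perm-injective ρ)

record Prescribed {n} (π : Permutation′ (3 + n)) (i j a b : Fin (3 + n)) : Set where
  field
    square   : Fin (3 + n) → Permutation′ (3 + n)
    latin    : IsLatin square
    first    : square 0F ≈ π
    ij-left  : square 1F ⟨$⟩ʳ i ≡ square 0F ⟨$⟩ʳ j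
    ij-right : square 1F ⟨$⟩ʳ j ≡ square 0F ⟨$⟩ʳ i
    ab-left  : square 2F ⟨$⟩ʳ a ≡ square 0F ⟨$⟩ʳ b
    ab-right : square 2F ⟨$⟩ʳ b ≡ square 0F ⟨$⟩ʳ a

Distinct₄ : ∀ {n} (i j a b : Fin n) → Set
Distinct₄ i j a b = i ≢ j × i ≢ a × i ≢ b × j ≢ a × j ≢ b × a ≢ b

-- The rows of the seed are composed on both sides with permutations that carry
-- its row 0 to π and its columns 0, 1, 2, 3 to i, j, a, b.
prescribe : ∀ {n} → Seed n → (π : Permutation′ (4 + n)) (i j a b : Fin (4 + n)) → Distinct₄ i j a b → Prescribed π i j a b
prescribe S π i j a b (i≢j , i≢a , i≢b , j≢a , j≢b , a≢b)
  with φ , φi ∷ φj ∷ φa ∷ φb ∷ [] ← extend ((i , 0F) ∷ (j , 1F) ∷ (a , 2F) ∷ (b , 3F) ∷ [])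
         (((i≢j , λ ()) ∷ (i≢a , λ ()) ∷ (i≢b , λ ()) ∷ []) ∷ ((j≢a , λ ()) ∷ (j≢b , λ ()) ∷ []) ∷ ((a≢b , λ ()) ∷ []) ∷ [] ∷ [])
  = record
  { square   = ℓ
  ; latin    = λ { s≢t (q , e) → latin s≢t (φ ⟨$⟩ʳ q , perm-injective ψ e) }
  ; first    = λ q → cong (π ⟨$⟩ʳ_) (trans (cong (φ ⟨$⟩ˡ_) (inverseˡ (square 0F))) (inverseˡ φ))
  ; ij-left  = meet 1F φi φj 01-left
  ; ij-right = meet 1F φj φi 01-right
  ; ab-left  = meet 2F φa φb 02-left
  ; ab-right = meet 2F φb φa 02-right
  }
  where
  open Seed S
  ψ = flip (square 0F) ∘ₚ flip φ ∘ₚ π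
  ℓ = λ t → φ ∘ₚ square t ∘ₚ ψ
  meet : ∀ t {x y u v} → φ ⟨$⟩ʳ x ≡ u → φ ⟨$⟩ʳ y ≡ v → square t ⟨$⟩ʳ u ≡ square 0F ⟨$⟩ʳ v → ℓ t ⟨$⟩ʳ x ≡ ℓ 0F ⟨$⟩ʳ y
  meet t refl refl e = cong (ψ ⟨$⟩ʳ_) e

-- Functions of degree one

sumℤ-zero : ∀ {n} {g : Fin n → ℤ} → (∀ i → g i ≡ 0ℤ) → sumℤ g ≡ 0ℤ
sumℤ-zero {zero}  g≡0 = refl
sumℤ-zero {suc n} g≡0 = cong₂ ℤ._+_ (g≡0 zero) (sumℤ-zero (g≡0 ∘ suc))

single : ∀ {n} → Fin n → ℤ → Fin n → ℤ
single c α i = if does (i ≟ c) then α else 0ℤ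

sumℤ-single : ∀ {n} (c : Fin n) α → sumℤ (single c α) ≡ α
sumℤ-single {suc n} zero α = trans (cong (ℤ._+_ α) (sumℤ-zero {n} λ _ → refl)) (ℤ.+-identityʳ α)
sumℤ-single (suc c) α = trans (ℤ.+-identityˡ _) (sumℤ-single c α)

sumℤ-change₂ : ∀ {n} (g h : Fin n → ℤ) c c′ → c ≢ c′ → (∀ i → i ≢ c → i ≢ c′ → g i ≡ h i) →
  sumℤ g ≡ sumℤ h ℤ.+ (g c ℤ.- h c) ℤ.+ (g c′ ℤ.- h c′)
sumℤ-change₂ g h c c′ c≢c′ same = begin
  sumℤ g
    ≡⟨ sumℤ-cong pointwise ⟩
  sumℤ (λ i → h i ℤ.+ single c α i ℤ.+ single c′ β i)
    ≡⟨ sumℤ-+ (λ i → h i ℤ.+ single c α i) (single c′ β) ⟩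
  sumℤ (λ i → h i ℤ.+ single c α i) ℤ.+ sumℤ (single c′ β)
    ≡⟨ cong₂ ℤ._+_ (trans (sumℤ-+ h (single c α)) (cong (ℤ._+_ (sumℤ h)) (sumℤ-single c α))) (sumℤ-single c′ β) ⟩
  sumℤ h ℤ.+ α ℤ.+ β ∎
  where
  open ≡-Reasoning
  α = g c ℤ.- h c
  β = g c′ ℤ.- h c′
  one : ∀ x y → x ≡ y ℤ.+ (x ℤ.- y) ℤ.+ 0ℤ
  one = solve-∀
  two : ∀ x y → x ≡ y ℤ.+ 0ℤ ℤ.+ (x ℤ.- y)
  two = solve-∀
  none : ∀ x → x ≡ x ℤ.+ 0ℤ ℤ.+ 0ℤ
  none = solve-∀
  pointwise : ∀ i → g i ≡ h i ℤ.+ single c α i ℤ.+ single c′ β i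
  pointwise i with i ≟ c | i ≟ c′
  ... | yes refl | yes refl = contradiction refl c≢c′
  ... | yes refl | no _     = one (g i) (h i)
  ... | no _     | yes refl = two (g i) (h i)
  ... | no i≢c   | no i≢c′  = trans (same i i≢c i≢c′) (none (h i))

self-negative : ∀ x → x ≡ ℤ.- x → x ≡ 0ℤ
self-negative (+ 0) _ = refl

-- A predicate in place of a `Family`: a cell can then be removed without rebuilding a list or
-- recomputing ν, since only the count on Latin squares has to be carried along.
record Balanced (n k : ℕ) : Set₁ where
  field
    P        : Permutation′ n → Set
    P?       : ∀ σ → Dec (P σ)
    P-resp   : ∀ σ τ → σ ≈ τ → P σ → P τ
    balanced : ∀ ℓ → IsLatin ℓ → ∑[ t < n ] ind (P? (ℓ t)) ≡ k

  χ : Permutation′ n → ℕ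
  χ σ = ind (P? σ)

  χ-cong : ∀ σ τ → σ ≈ τ → χ σ ≡ χ τ
  χ-cong σ τ e = ind-cong (P? σ) (P? τ) (P-resp σ τ e) (P-resp τ σ λ i → sym (e i))

  f : Permutation′ n → ℤ
  f σ = + χ σ

  f-cong : ∀ σ τ → σ ≈ τ → f σ ≡ f τ
  f-cong σ τ e = cong +_ (χ-cong σ τ e)

module Differences {n′ k} (S : Seed n′) (B : Balanced (4 + n′) k) where
  open Balanced B
  private
    n = 4 + n′

  -- Both squares have count k and share all rows from 2 on, which cancel.
  switch-pair : (ℓ : Fin n → Permutation′ n) → IsLatin ℓ → ∀ i j →
    ℓ 1F ⟨$⟩ʳ i ≡ ℓ 0F ⟨$⟩ʳ j → ℓ 1F ⟨$⟩ʳ j ≡ ℓ 0F ⟨$⟩ʳ i →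
    χ (ℓ 0F) + χ (ℓ 1F) ≡ χ (sw i j (ℓ 0F)) + χ (sw i j (ℓ 1F))
  switch-pair ℓ L i j eᵢ eⱼ = ℕ.+-cancelʳ-≡ rest _ _ (begin
    χ (ℓ 0F) + χ (ℓ 1F) + rest                      ≡⟨ ℕ.+-assoc (χ (ℓ 0F)) _ _ ⟩
    sum (χ ∘ ℓ)                                     ≡⟨ balanced ℓ L ⟩
    k                                               ≡⟨ balanced switched switched-latin ⟨
    sum (χ ∘ switched)                              ≡⟨ ℕ.+-assoc (χ (sw i j (ℓ 0F))) _ _ ⟨
    χ (sw i j (ℓ 0F)) + χ (sw i j (ℓ 1F)) + rest    ∎)
    where
    open ≡-Reasoning
    open Switch ℓ L i j eᵢ eⱼ
    rest = sum (λ t → χ (ℓ (suc (suc t))))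

  -- Switch rows 0, 1 on {i, j}, before and after switching rows 0, 2 on {a, b}, and subtract.
  commuting-differences′ : ∀ σ i j a b → Distinct₄ i j a b → Prescribed σ i j a b →
    f (sw i j (sw a b σ)) ℤ.- f (sw a b σ) ≡ f (sw i j σ) ℤ.- f σ
  commuting-differences′ σ i j a b (i≢j , i≢a , i≢b , j≢a , j≢b , a≢b) R = begin
    f (sw i j (sw a b σ)) ℤ.- f (sw a b σ)    ≡⟨ cong₂ ℤ._-_ (f-cong (sw i j (sw a b ρ)) (sw i j (sw a b σ)) (sw-cong i j {sw a b ρ} {sw a b σ} (sw-cong a b {ρ} {σ} first))) (f-cong (sw a b ρ) (sw a b σ) (sw-cong a b {ρ} {σ} first)) ⟨
    f (sw i j (sw a b ρ)) ℤ.- f (sw a b ρ)    ≡⟨ arith (f ρ) (f (square 1F)) (f (sw i j ρ)) (f (sw i j (square 1F))) (f (sw a b ρ)) (f (sw i j (sw a b ρ))) (cong +_ before) (cong +_ after) ⟩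
    f (sw i j ρ) ℤ.- f ρ                      ≡⟨ cong₂ ℤ._-_ (f-cong (sw i j ρ) (sw i j σ) (sw-cong i j {ρ} {σ} first)) (f-cong ρ σ first) ⟩
    f (sw i j σ) ℤ.- f σ                      ∎
    where
    open ≡-Reasoning
    open Prescribed R
    ρ = square 0F
    t₁₂ : Permutation′ n
    t₁₂ = transpose 1F 2F
    before : χ ρ + χ (square 1F) ≡ χ (sw i j ρ) + χ (sw i j (square 1F))
    before = switch-pair square latin i j ij-left ij-right
    open Switch (λ t → square (t₁₂ ⟨$⟩ʳ t)) (reindex-latin square latin t₁₂) a b ab-left ab-right
    keep : ∀ {q} → q ≢ a → q ≢ b → sw a b ρ ⟨$⟩ʳ q ≡ ρ ⟨$⟩ʳ q
    keep = sw-other a b ρ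
    after : χ (sw a b ρ) + χ (square 1F) ≡ χ (sw i j (sw a b ρ)) + χ (sw i j (square 1F))
    after = switch-pair (λ t → switched (t₁₂ ⟨$⟩ʳ t)) (reindex-latin switched (λ {s} {t} → switched-latin {s} {t}) t₁₂) i j
      (trans ij-left (sym (keep j≢a j≢b))) (trans ij-right (sym (keep i≢a i≢b)))
    arith : ∀ p q r u v w → p ℤ.+ q ≡ r ℤ.+ u → v ℤ.+ q ≡ w ℤ.+ u → w ℤ.- v ≡ r ℤ.- p
    arith p q r u v w e e′ = begin
      w ℤ.- v                                 ≡⟨ lemma₁ w v u ⟩
      (w ℤ.+ u) ℤ.- v ℤ.- u                   ≡⟨ cong (λ z → z ℤ.- v ℤ.- u) e′ ⟨
      (v ℤ.+ q) ℤ.- v ℤ.- u                   ≡⟨ lemma₂ v q u p ⟩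
      (p ℤ.+ q) ℤ.- p ℤ.- u                   ≡⟨ cong (λ z → z ℤ.- p ℤ.- u) e ⟩
      (r ℤ.+ u) ℤ.- p ℤ.- u                   ≡⟨ lemma₁ r p u ⟨
      r ℤ.- p                                 ∎
      where
      lemma₁ : ∀ w v u → w ℤ.- v ≡ (w ℤ.+ u) ℤ.- v ℤ.- u
      lemma₁ = solve-∀
      lemma₂ : ∀ v q u p → (v ℤ.+ q) ℤ.- v ℤ.- u ≡ (p ℤ.+ q) ℤ.- p ℤ.- u
      lemma₂ = solve-∀

  commuting-differences : ∀ σ i j a b → Distinct₄ i j a b →
    f (sw i j (sw a b σ)) ℤ.- f (sw a b σ) ≡ f (sw i j σ) ℤ.- f σ
  commuting-differences σ i j a b dist = commuting-differences′ σ i j a b dist (prescribe S σ i j a b dist)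

  Δ : Fin n → Fin n → Permutation′ n → ℤ
  Δ i j σ = f (sw i j σ) ℤ.- f σ

  Δ-cong : ∀ i j σ τ → σ ≈ τ → Δ i j σ ≡ Δ i j τ
  Δ-cong i j σ τ e = cong₂ ℤ._-_ (f-cong _ _ (sw-cong i j e)) (f-cong σ τ e)

  -- `connect` transposes only places where the two permutations still differ, hence never i or j,
  -- and such transpositions do not affect the difference.
  Δ-local : ∀ {i j} → i ≢ j → ∀ σ τ → σ ⟨$⟩ʳ i ≡ τ ⟨$⟩ʳ i → σ ⟨$⟩ʳ j ≡ τ ⟨$⟩ʳ j → Δ i j σ ≡ Δ i j τ
  Δ-local {i} {j} i≢j σ τ = connect τ
    (λ σ → σ ⟨$⟩ʳ i ≡ τ ⟨$⟩ʳ i → σ ⟨$⟩ʳ j ≡ τ ⟨$⟩ʳ j → Δ i j σ ≡ Δ i j τ)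
    (λ σ e _ _ → Δ-cong i j σ τ e)
    (λ σ c c′ c≢c′ c≁ c′≁ ih eᵢ eⱼ →
      let i≢c  = λ { refl → c≁ eᵢ }
          i≢c′ = λ { refl → c′≁ eᵢ }
          j≢c  = λ { refl → c≁ eⱼ }
          j≢c′ = λ { refl → c′≁ eⱼ }
      in trans (sym (commuting-differences σ i j c c′ (i≢j , i≢c , i≢c′ , j≢c , j≢c′ , c≢c′)))
           (ih (trans (sw-other c c′ σ i≢c i≢c′) eᵢ) (trans (sw-other c c′ σ j≢c j≢c′) eⱼ)))
    σ

  representative : ∀ {i j x y : Fin n} → i ≢ j → x ≢ y →
    ∃ λ (σ : Permutation′ n) → σ ⟨$⟩ʳ i ≡ x × σ ⟨$⟩ʳ j ≡ y
  representative {i} {j} {x} {y} i≢j x≢y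
    with σ , eᵢ ∷ eⱼ ∷ [] ← extend ((i , x) ∷ (j , y) ∷ []) (((i≢j , x≢y) ∷ []) ∷ [] ∷ []) = σ , eᵢ , eⱼ

  opaque
    D′ : ∀ {i j x y : Fin n} → Dec (i ≡ j) → Dec (x ≡ y) → ℤ
    D′ {i} {j} (no i≢j) (no x≢y) = Δ i j (proj₁ (representative i≢j x≢y))
    -- For `i ≡ j` the difference vanishes; for distinct places equal values never occur. Zero in
    -- both cases keeps antisymmetry and additivity free of exceptions.
    D′ _ _ = 0ℤ

    D : (i j x y : Fin n) → ℤ
    D i j x y = D′ (i ≟ j) (x ≟ y)

    D-eq : ∀ i j {x y} σ → σ ⟨$⟩ʳ i ≡ x → σ ⟨$⟩ʳ j ≡ y → D i j x y ≡ f (sw i j σ) ℤ.- f σ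
    D-eq i j {x} {y} σ eᵢ eⱼ with i ≟ j | x ≟ y
    ... | yes refl | _ = trans (sym (ℤ.+-inverseʳ (f σ))) (cong (ℤ._- f σ) (f-cong σ (sw i i σ) (sw-diag i σ)))
    ... | no i≢j | yes refl = contradiction (perm-injective σ (trans eᵢ (sym eⱼ))) i≢j
    ... | no i≢j | no x≢y = let τ , τᵢ , τⱼ = representative i≢j x≢y in
      Δ-local i≢j τ σ (trans τᵢ (sym eᵢ)) (trans τⱼ (sym eⱼ))

    D-diagˡ : ∀ i x y → D i i x y ≡ 0ℤ
    D-diagˡ i x y with i ≟ i
    ... | yes _ = refl
    ... | no i≢i = contradiction refl i≢i

    D-diagʳ : ∀ i j x → D i j x x ≡ 0ℤ
    D-diagʳ i j x with i ≟ j | x ≟ x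
    ... | yes _ | _ = refl
    ... | no _ | yes _ = refl
    ... | no _ | no x≢x = contradiction refl x≢x

  minus : ∀ a b → a ℤ.- b ≡ ℤ.- (b ℤ.- a)
  minus = solve-∀

  D-antisymʳ : ∀ i j x y → D i j y x ≡ ℤ.- D i j x y
  D-antisymʳ i j x y with i ≟ j | x ≟ y
  ... | yes refl | _ = trans (D-diagˡ i y x) (cong ℤ.-_ (sym (D-diagˡ i x y)))
  ... | no _ | yes refl = trans (D-diagʳ i j x) (cong ℤ.-_ (sym (D-diagʳ i j x)))
  ... | no i≢j | no x≢y with σ , eᵢ , eⱼ ← representative i≢j x≢y = begin
    D i j y x                                  ≡⟨ D-eq i j (sw i j σ) (trans (sw-left i j σ) eⱼ) (trans (sw-right i j σ) eᵢ) ⟩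
    f (sw i j (sw i j σ)) ℤ.- f (sw i j σ)     ≡⟨ cong (ℤ._- f (sw i j σ)) (f-cong _ _ (sw-involutive i j σ)) ⟨
    f σ ℤ.- f (sw i j σ)                       ≡⟨ minus (f σ) (f (sw i j σ)) ⟩
    ℤ.- (f (sw i j σ) ℤ.- f σ)                 ≡⟨ cong ℤ.-_ (D-eq i j σ eᵢ eⱼ) ⟨
    ℤ.- D i j x y                              ∎
    where open ≡-Reasoning

  D-flip : ∀ i j x y → D j i y x ≡ D i j x y
  D-flip i j x y with i ≟ j | x ≟ y
  ... | yes refl | _ = trans (D-diagˡ i y x) (sym (D-diagˡ i x y))
  ... | no _ | yes refl = trans (D-diagʳ j i x) (sym (D-diagʳ i j x))
  ... | no i≢j | no x≢y with σ , eᵢ , eⱼ ← representative i≢j x≢y =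
    trans (D-eq j i σ eⱼ eᵢ) (trans (cong (ℤ._- f σ) (f-cong _ _ (sw-sym i j σ))) (sym (D-eq i j σ eᵢ eⱼ)))

  D-antisymˡ : ∀ i j x y → D j i x y ≡ ℤ.- D i j x y
  D-antisymˡ i j x y = trans (D-antisymʳ j i y x) (cong ℤ.-_ (D-flip i j x y))

  module Triple (i j l : Fin n) (i≢j : i ≢ j) (i≢l : i ≢ l) (j≢l : j ≢ l) (σ : Permutation′ n) where

    record Arranged (x y z : Fin n) (p : Permutation′ n) : Set where
      constructor arranged
      field
        at-i   : p ⟨$⟩ʳ i ≡ x
        at-j   : p ⟨$⟩ʳ j ≡ y
        at-l   : p ⟨$⟩ʳ l ≡ z
        at-else : ∀ q → q ≢ i → q ≢ j → q ≢ l → p ⟨$⟩ʳ q ≡ σ ⟨$⟩ʳ q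

    swap-ij : ∀ {x y z p} → Arranged x y z p → Arranged y x z (sw i j p)
    swap-ij {p = p} (arranged eᵢ eⱼ eₗ e) = arranged (trans (sw-left i j p) eⱼ) (trans (sw-right i j p) eᵢ)
      (trans (sw-other i j p (i≢l ∘ sym) (j≢l ∘ sym)) eₗ) λ q q≢i q≢j q≢l → trans (sw-other i j p q≢i q≢j) (e q q≢i q≢j q≢l)

    swap-jl : ∀ {x y z p} → Arranged x y z p → Arranged x z y (sw j l p)
    swap-jl {p = p} (arranged eᵢ eⱼ eₗ e) = arranged (trans (sw-other j l p i≢j i≢l) eᵢ)
      (trans (sw-left j l p) eₗ) (trans (sw-right j l p) eⱼ) λ q q≢i q≢j q≢l → trans (sw-other j l p q≢j q≢l) (e q q≢i q≢j q≢l)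

    swap-li : ∀ {x y z p} → Arranged x y z p → Arranged z y x (sw l i p)
    swap-li {p = p} (arranged eᵢ eⱼ eₗ e) = arranged (trans (sw-right l i p) eₗ)
      (trans (sw-other l i p j≢l (i≢j ∘ sym)) eⱼ) (trans (sw-left l i p) eᵢ) λ q q≢i q≢j q≢l → trans (sw-other l i p q≢l q≢i) (e q q≢i q≢j q≢l)

    same : ∀ {x y z p p′} → Arranged x y z p → Arranged x y z p′ → p ≈ p′
    same (arranged eᵢ eⱼ eₗ e) (arranged eᵢ′ eⱼ′ eₗ′ e′) q with q ≟ i | q ≟ j | q ≟ l
    ... | yes refl | _ | _ = trans eᵢ (sym eᵢ′)
    ... | no _ | yes refl | _ = trans eⱼ (sym eⱼ′)
    ... | no _ | no _ | yes refl = trans eₗ (sym eₗ′)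
    ... | no q≢i | no q≢j | no q≢l = trans (e q q≢i q≢j q≢l) (sym (e′ q q≢i q≢j q≢l))

  -- The sum of D i j around a cycle of values; it is the alternating sum of f
  -- over the six arrangements of x, y, z on the places i, j and any third place.
  C : (i j x y z : Fin n) → ℤ
  C i j x y z = D i j x y ℤ.+ D i j y z ℤ.+ D i j z x

  module _ {i j l : Fin n} (i≢j : i ≢ j) (i≢l : i ≢ l) (j≢l : j ≢ l)
           {x y z : Fin n} (x≢y : x ≢ y) (x≢z : x ≢ z) (y≢z : y ≢ z) where

    -- Swapping ij and jl in turn walks through the six arrangements of x, y, z and closes up. The
    -- three ij edges and the three jl edges give the same alternating sum; the li term is the
    -- diagonal from p₂ to p₅. The second equation serves additivity in the places.
    hexagon : C i j x y z ≡ C j l x y z × D i j x y ℤ.+ D j l x y ℤ.+ D l i x y ≡ C i j x y z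
    hexagon with σ , eᵢ ∷ eⱼ ∷ eₗ ∷ [] ← extend ((i , x) ∷ (j , y) ∷ (l , z) ∷ [])
                   (((i≢j , x≢y) ∷ (i≢l , x≢z) ∷ []) ∷ ((j≢l , y≢z) ∷ []) ∷ [] ∷ []) =
      (begin
        C i j x y z
          ≡⟨ cong₂ ℤ._+_ (cong₂ ℤ._+_ ij-xy ij-yz) ij-zx ⟩
        (f p₁ ℤ.- f p₀) ℤ.+ (f p₃ ℤ.- f p₂) ℤ.+ (f p₅ ℤ.- f p₄)
          ≡⟨ lemma₁ (f p₀) (f p₁) (f p₂) (f p₃) (f p₄) (f p₅) ⟩
        ℤ.- (f p₄ ℤ.- f p₃) ℤ.+ ℤ.- (f p₀ ℤ.- f p₅) ℤ.+ ℤ.- (f p₂ ℤ.- f p₁)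
          ≡⟨ cong₂ ℤ._+_ (cong₂ ℤ._+_ jl-xy (trans (D-antisymʳ j l z y) (cong ℤ.-_ jl-zy))) (trans (D-antisymʳ j l x z) (cong ℤ.-_ jl-xz)) ⟨
        C j l x y z ∎) ,
      (begin
        D i j x y ℤ.+ D j l x y ℤ.+ D l i x y
          ≡⟨ cong₂ ℤ._+_ (cong₂ ℤ._+_ ij-xy jl-xy) li-xy ⟩
        (f p₁ ℤ.- f p₀) ℤ.+ ℤ.- (f p₄ ℤ.- f p₃) ℤ.+ (f p₅ ℤ.- f p₂)
          ≡⟨ lemma₂ (f p₀) (f p₁) (f p₂) (f p₃) (f p₄) (f p₅) ⟩
        (f p₁ ℤ.- f p₀) ℤ.+ (f p₃ ℤ.- f p₂) ℤ.+ (f p₅ ℤ.- f p₄)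
          ≡⟨ cong₂ ℤ._+_ (cong₂ ℤ._+_ ij-xy ij-yz) ij-zx ⟨
        C i j x y z ∎)
      where
      open ≡-Reasoning
      open Triple i j l i≢j i≢l j≢l σ
      open Arranged
      p₀ = σ
      p₁ = sw i j p₀
      p₂ = sw j l p₁
      p₃ = sw i j p₂
      p₄ = sw j l p₃
      p₅ = sw i j p₄
      a₀ : Arranged x y z p₀
      a₀ = arranged eᵢ eⱼ eₗ λ _ _ _ _ → refl
      a₁ = swap-ij a₀
      a₂ = swap-jl a₁
      a₃ = swap-ij a₂
      a₄ = swap-jl a₃
      a₅ = swap-ij a₄
      ij-xy : D i j x y ≡ f p₁ ℤ.- f p₀
      ij-xy = D-eq i j p₀ (at-i a₀) (at-j a₀)
      ij-yz : D i j y z ≡ f p₃ ℤ.- f p₂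
      ij-yz = D-eq i j p₂ (at-i a₂) (at-j a₂)
      ij-zx : D i j z x ≡ f p₅ ℤ.- f p₄
      ij-zx = D-eq i j p₄ (at-i a₄) (at-j a₄)
      jl-xz : D j l x z ≡ f p₂ ℤ.- f p₁
      jl-xz = D-eq j l p₁ (at-j a₁) (at-l a₁)
      jl-xy : D j l x y ≡ ℤ.- (f p₄ ℤ.- f p₃)
      jl-xy = trans (D-antisymʳ j l y x) (cong ℤ.-_ (D-eq j l p₃ (at-j a₃) (at-l a₃)))
      jl-zy : D j l z y ≡ f p₀ ℤ.- f p₅
      jl-zy = trans (D-eq j l p₅ (at-j a₅) (at-l a₅)) (cong (ℤ._- f p₅) (f-cong _ _ (same (swap-jl a₅) a₀)))
      li-xy : D l i x y ≡ f p₅ ℤ.- f p₂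
      li-xy = trans (D-eq l i p₂ (at-l a₂) (at-i a₂)) (cong (ℤ._- f p₂) (f-cong _ _ (same (swap-li a₂) a₅)))
      lemma₁ : ∀ f₀ f₁ f₂ f₃ f₄ f₅ → (f₁ ℤ.- f₀) ℤ.+ (f₃ ℤ.- f₂) ℤ.+ (f₅ ℤ.- f₄) ≡
        ℤ.- (f₄ ℤ.- f₃) ℤ.+ ℤ.- (f₀ ℤ.- f₅) ℤ.+ ℤ.- (f₂ ℤ.- f₁)
      lemma₁ = solve-∀
      lemma₂ : ∀ f₀ f₁ f₂ f₃ f₄ f₅ → (f₁ ℤ.- f₀) ℤ.+ ℤ.- (f₄ ℤ.- f₃) ℤ.+ (f₅ ℤ.- f₂) ≡
        (f₁ ℤ.- f₀) ℤ.+ (f₃ ℤ.- f₂) ℤ.+ (f₅ ℤ.- f₄)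
      lemma₂ = solve-∀

  C-antisym : ∀ i j x y z → C j i x y z ≡ ℤ.- C i j x y z
  C-antisym i j x y z = trans
    (cong₂ ℤ._+_ (cong₂ ℤ._+_ (D-antisymˡ i j x y) (D-antisymˡ i j y z)) (D-antisymˡ i j z x))
    (lemma (D i j x y) (D i j y z) (D i j z x))
    where
    lemma : ∀ a b c → ℤ.- a ℤ.+ ℤ.- b ℤ.+ ℤ.- c ≡ ℤ.- (a ℤ.+ b ℤ.+ c)
    lemma = solve-∀

  -- By the hexagon C j l = C l i = C i q = C q l = - C l q = - C j l.
  C-zero : ∀ {i j x y z} → i ≢ j → x ≢ y → x ≢ z → y ≢ z → C i j x y z ≡ 0ℤ
  C-zero {i} {j} {x} {y} {z} i≢j x≢y x≢z y≢z
    with φ , refl ∷ refl ∷ [] ← extend ((0F , i) ∷ (1F , j) ∷ []) ((((λ ()) , i≢j) ∷ []) ∷ [] ∷ []) =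
    trans (hex i≢j (ne λ ()) (ne λ ())) (self-negative (C j l x y z) (begin
      C j l x y z       ≡⟨ hex (ne λ ()) (ne λ ()) (ne λ ()) ⟩
      C l i x y z       ≡⟨ hex (ne λ ()) (ne λ ()) (ne λ ()) ⟩
      C i q x y z       ≡⟨ hex (ne λ ()) (ne λ ()) (ne λ ()) ⟩
      C q l x y z       ≡⟨ C-antisym l q x y z ⟩
      ℤ.- C l q x y z   ≡⟨ cong ℤ.-_ (hex (ne λ ()) (ne λ ()) (ne λ ())) ⟨
      ℤ.- C j l x y z   ∎))
    where
    open ≡-Reasoning
    l = φ ⟨$⟩ʳ 2F
    q = φ ⟨$⟩ʳ 3F
    ne : ∀ {u v} → u ≢ v → φ ⟨$⟩ʳ u ≢ φ ⟨$⟩ʳ v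
    ne u≢v = u≢v ∘ perm-injective φ
    hex : ∀ {i j l} → i ≢ j → i ≢ l → j ≢ l → C i j x y z ≡ C j l x y z
    hex i≢j i≢l j≢l = proj₁ (hexagon i≢j i≢l j≢l x≢y x≢z y≢z)

  D-addʳ : ∀ i j x y z → D i j x y ℤ.+ D i j y z ≡ D i j x z
  D-addʳ i j x y z with i ≟ j | x ≟ y | x ≟ z | y ≟ z
  ... | yes refl | _ | _ | _ = trans (cong₂ ℤ._+_ (D-diagˡ i x y) (D-diagˡ i y z)) (sym (D-diagˡ i x z))
  ... | no _ | yes refl | _ | _ = trans (cong (ℤ._+ D i j x z) (D-diagʳ i j x)) (ℤ.+-identityˡ _)
  ... | no _ | no _ | yes refl | _ = trans (cong (ℤ._+_ (D i j x y)) (D-antisymʳ i j x y))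
                                       (trans (ℤ.+-inverseʳ (D i j x y)) (sym (D-diagʳ i j x)))
  ... | no _ | no _ | no _ | yes refl = trans (cong (ℤ._+_ (D i j x y)) (D-diagʳ i j y)) (ℤ.+-identityʳ _)
  ... | no i≢j | no x≢y | no x≢z | no y≢z = begin
    D i j x y ℤ.+ D i j y z                       ≡⟨ lemma (D i j x y) (D i j y z) (D i j z x) ⟩
    C i j x y z ℤ.- D i j z x                     ≡⟨ cong (ℤ._- D i j z x) (C-zero i≢j x≢y x≢z y≢z) ⟩
    0ℤ ℤ.- D i j z x                              ≡⟨ ℤ.+-identityˡ _ ⟩
    ℤ.- D i j z x                                 ≡⟨ D-antisymʳ i j z x ⟨
    D i j x z                                     ∎
    where
    open ≡-Reasoning
    lemma : ∀ a b c → a ℤ.+ b ≡ a ℤ.+ b ℤ.+ c ℤ.- c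
    lemma = solve-∀

  D-addˡ : ∀ i j l x y → D i j x y ℤ.+ D j l x y ≡ D i l x y
  D-addˡ i j l x y with x ≟ y | i ≟ j | i ≟ l | j ≟ l
  ... | yes refl | _ | _ | _ = trans (cong₂ ℤ._+_ (D-diagʳ i j x) (D-diagʳ j l x)) (sym (D-diagʳ i l x))
  ... | no _ | yes refl | _ | _ = trans (cong (ℤ._+ D i l x y) (D-diagˡ i x y)) (ℤ.+-identityˡ _)
  ... | no _ | no _ | yes refl | _ = trans (cong (ℤ._+_ (D i j x y)) (D-antisymˡ i j x y))
                                       (trans (ℤ.+-inverseʳ (D i j x y)) (sym (D-diagˡ i x y)))
  ... | no _ | no _ | no _ | yes refl = trans (cong (ℤ._+_ (D i j x y)) (D-diagˡ j x y)) (ℤ.+-identityʳ _)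
  ... | no x≢y | no i≢j | no i≢l | no j≢l
    -- `φ` supplies a third value `φ ⟨$⟩ʳ 2F`, distinct from x and y, which the hexagon requires.
    with φ , refl ∷ refl ∷ [] ← extend ((0F , x) ∷ (1F , y) ∷ []) ((((λ ()) , x≢y) ∷ []) ∷ [] ∷ []) = begin
    D i j x y ℤ.+ D j l x y                                         ≡⟨ lemma (D i j x y) (D j l x y) (D l i x y) ⟩
    D i j x y ℤ.+ D j l x y ℤ.+ D l i x y ℤ.- D l i x y             ≡⟨ cong (ℤ._- D l i x y) vanish ⟩
    0ℤ ℤ.- D l i x y                                                ≡⟨ ℤ.+-identityˡ _ ⟩
    ℤ.- D l i x y                                                   ≡⟨ D-antisymˡ l i x y ⟨
    D i l x y                                                       ∎
    where
    open ≡-Reasoning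
    lemma : ∀ a b c → a ℤ.+ b ≡ a ℤ.+ b ℤ.+ c ℤ.- c
    lemma = solve-∀
    x≢z : φ ⟨$⟩ʳ 0F ≢ φ ⟨$⟩ʳ 2F
    x≢z e = contradiction (perm-injective φ e) λ ()
    y≢z : φ ⟨$⟩ʳ 1F ≢ φ ⟨$⟩ʳ 2F
    y≢z e = contradiction (perm-injective φ e) λ ()
    vanish = trans (proj₂ (hexagon i≢j i≢l j≢l x≢y x≢z y≢z)) (C-zero i≢j x≢y x≢z y≢z)

  -- A potential for D, obtained by fixing 0F as base place and base value. Additivity in places and
  -- in values makes D its mixed second difference.
  b : (i x : Fin n) → ℤ
  b i x = D 0F i x 0F

  D-b : ∀ i j x y → D i j x y ≡ b i y ℤ.+ b j x ℤ.- b i x ℤ.- b j y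
  D-b i j x y = sym (begin
    b i y ℤ.+ b j x ℤ.- b i x ℤ.- b j y
      ≡⟨ cong₂ (λ u v → u ℤ.+ v ℤ.- b i x ℤ.- b j y) (D-addʳ 0F i y x 0F) (D-addʳ 0F j x y 0F) ⟨
    (D 0F i y x ℤ.+ b i x) ℤ.+ (D 0F j x y ℤ.+ b j y) ℤ.- b i x ℤ.- b j y
      ≡⟨ cong₂ (λ u v → (u ℤ.+ b i x) ℤ.+ (v ℤ.+ b j y) ℤ.- b i x ℤ.- b j y) (D-antisymʳ 0F i x y) (sym (D-addˡ 0F i j x y)) ⟩
    (ℤ.- D 0F i x y ℤ.+ b i x) ℤ.+ (D 0F i x y ℤ.+ D i j x y ℤ.+ b j y) ℤ.- b i x ℤ.- b j y
      ≡⟨ lemma (D 0F i x y) (b i x) (D i j x y) (b j y) ⟩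
    D i j x y ∎)
    where
    open ≡-Reasoning
    lemma : ∀ d p e q → (ℤ.- d ℤ.+ p) ℤ.+ (d ℤ.+ e ℤ.+ q) ℤ.- p ℤ.- q ≡ e
    lemma = solve-∀

  c₀ : ℤ
  c₀ = f id ℤ.- sumℤ (λ i → b i i)

  -- A transposition changes both sides by the same D, and c₀ is chosen to make them agree at `id`.
  f-degree-one : ∀ σ → f σ ≡ c₀ ℤ.+ sumℤ (λ i → b i (σ ⟨$⟩ʳ i))
  f-degree-one = connect id (λ σ → f σ ≡ c₀ ℤ.+ sumℤ (λ i → b i (σ ⟨$⟩ʳ i))) base step
    where
    base : ∀ σ → σ ≈ id → f σ ≡ c₀ ℤ.+ sumℤ (λ i → b i (σ ⟨$⟩ʳ i))
    base σ e = trans (f-cong σ id e) (trans (lemma (f id) (sumℤ (λ i → b i i)))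
      (cong (ℤ._+_ c₀) (sumℤ-cong λ i → cong (b i) (sym (e i)))))
      where
      lemma : ∀ a s → a ≡ a ℤ.- s ℤ.+ s
      lemma = solve-∀
    step : ∀ σ c c′ → c ≢ c′ → _ → _ → f (sw c c′ σ) ≡ c₀ ℤ.+ sumℤ (λ i → b i (sw c c′ σ ⟨$⟩ʳ i)) →
      f σ ≡ c₀ ℤ.+ sumℤ (λ i → b i (σ ⟨$⟩ʳ i))
    step σ c c′ c≢c′ _ _ ih = begin
      f σ
        ≡⟨ lemma₁ (f σ) (f (sw c c′ σ)) ⟩
      f (sw c c′ σ) ℤ.- (f (sw c c′ σ) ℤ.- f σ)
        ≡⟨ cong₂ ℤ._-_ ih (trans (sym (D-eq c c′ σ refl refl)) (D-b c c′ (σ ⟨$⟩ʳ c) (σ ⟨$⟩ʳ c′))) ⟩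
      c₀ ℤ.+ sumℤ (λ i → b i (sw c c′ σ ⟨$⟩ʳ i)) ℤ.- (b c y ℤ.+ b c′ x ℤ.- b c x ℤ.- b c′ y)
        ≡⟨ cong (λ s → c₀ ℤ.+ s ℤ.- (b c y ℤ.+ b c′ x ℤ.- b c x ℤ.- b c′ y)) change ⟩
      c₀ ℤ.+ (s₀ ℤ.+ (b c y ℤ.- b c x) ℤ.+ (b c′ x ℤ.- b c′ y)) ℤ.- (b c y ℤ.+ b c′ x ℤ.- b c x ℤ.- b c′ y)
        ≡⟨ lemma₂ c₀ s₀ (b c y) (b c′ x) (b c x) (b c′ y) ⟩
      c₀ ℤ.+ s₀ ∎
      where
      open ≡-Reasoning
      x = σ ⟨$⟩ʳ c
      y = σ ⟨$⟩ʳ c′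
      s₀ = sumℤ (λ i → b i (σ ⟨$⟩ʳ i))
      change : sumℤ (λ i → b i (sw c c′ σ ⟨$⟩ʳ i)) ≡ s₀ ℤ.+ (b c y ℤ.- b c x) ℤ.+ (b c′ x ℤ.- b c′ y)
      change = trans (sumℤ-change₂ (λ i → b i (sw c c′ σ ⟨$⟩ʳ i)) (λ i → b i (σ ⟨$⟩ʳ i)) c c′ c≢c′
          λ i i≢c i≢c′ → cong (b i) (sw-other c c′ σ i≢c i≢c′))
        (cong₂ (λ u v → s₀ ℤ.+ (b c u ℤ.- b c x) ℤ.+ (b c′ v ℤ.- b c′ y)) (sw-left c c′ σ) (sw-right c c′ σ))
      lemma₁ : ∀ p q → p ≡ q ℤ.- (q ℤ.- p)
      lemma₁ = solve-∀
      lemma₂ : ∀ c s p q r t → c ℤ.+ (s ℤ.+ (p ℤ.- r) ℤ.+ (q ℤ.- t)) ℤ.- (p ℤ.+ q ℤ.- r ℤ.- t) ≡ c ℤ.+ s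
      lemma₂ = solve-∀

-- Sensitive transpositions

sumℤ-const : ∀ n x → sumℤ {n} (λ _ → x) ≡ + n ℤ.* x
sumℤ-const zero    x = sym (ℤ.*-zeroˡ x)
sumℤ-const (suc n) x = trans (cong (ℤ._+_ x) (sumℤ-const n x)) (sym (ℤ.suc-* (+ n) x))

sumℤ-pos : ∀ {n} (g : Fin n → ℕ) → sumℤ (λ i → + g i) ≡ + sum g
sumℤ-pos {zero}  g = refl
sumℤ-pos {suc n} g = cong (ℤ._+_ (+ g zero)) (sumℤ-pos (g ∘ suc))

latin-column : ∀ {n} (ℓ : Fin n → Permutation′ n) → IsLatin ℓ → Fin n → Permutation′ n
latin-column ℓ L i = injective⇒perm (λ t → ℓ t ⟨$⟩ʳ i) inj
  where
  inj : ∀ {s t} → ℓ s ⟨$⟩ʳ i ≡ ℓ t ⟨$⟩ʳ i → s ≡ t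
  inj {s} {t} e with s ≟ t
  ... | yes p = p
  ... | no s≢t = contradiction (i , e) (L s≢t)

module Dictator {n′ k} (S : Seed n′) (B : Balanced (4 + n′) k) where
  open Balanced B
  open Differences S B
  private
    n = 4 + n′

  total : ℤ
  total = sumℤ λ i → sumℤ λ x → b i x

  -- Each column of a Latin square runs through all symbols, so summing f over the rows meets every
  -- `b i x` exactly once.
  latin-total : + k ≡ + n ℤ.* c₀ ℤ.+ total
  latin-total = begin
    + k
      ≡⟨ cong +_ (balanced square latin) ⟨
    + sum (χ ∘ square)
      ≡⟨ sumℤ-pos (χ ∘ square) ⟨
    sumℤ (λ t → f (square t))
      ≡⟨ sumℤ-cong (λ t → f-degree-one (square t)) ⟩
    sumℤ (λ t → c₀ ℤ.+ sumℤ (λ i → b i (square t ⟨$⟩ʳ i)))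
      ≡⟨ sumℤ-+ (λ _ → c₀) (λ t → sumℤ (λ i → b i (square t ⟨$⟩ʳ i))) ⟩
    sumℤ {n} (λ _ → c₀) ℤ.+ sumℤ (λ t → sumℤ (λ i → b i (square t ⟨$⟩ʳ i)))
      ≡⟨ cong₂ ℤ._+_ (sumℤ-const n c₀) (sumℤ-comm (λ t i → b i (square t ⟨$⟩ʳ i))) ⟩
    + n ℤ.* c₀ ℤ.+ sumℤ (λ i → sumℤ (λ t → b i (square t ⟨$⟩ʳ i)))
      ≡⟨ cong (ℤ._+_ (+ n ℤ.* c₀)) (sumℤ-cong λ i → sumℤ-permute (b i) (latin-column square latin i)) ⟨
    + n ℤ.* c₀ ℤ.+ total ∎
    where
    open ≡-Reasoning
    open Seed S

  sensitive : Permutation′ n → Fin n → Fin n → ℕ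
  sensitive σ i j = ind (¬? (P? (sw i j σ)))

  sensitive+f : ∀ σ i j → + sensitive σ i j ℤ.+ f (sw i j σ) ≡ + 1
  sensitive+f σ i j with P? (sw i j σ)
  ... | yes _ = refl
  ... | no _  = refl

  f-true : ∀ {σ} → P σ → f σ ≡ + 1
  f-true {σ} p = cong +_ (ind-true (P? σ) p)

  f-false : ∀ {σ} → ¬ P σ → f σ ≡ 0ℤ
  f-false {σ} ¬p = cong +_ (ind-false (P? σ) ¬p)

  -- Summing `pointwise` over all ordered pairs gives 2 n s₀ = E + 2 `total`. Now c₀ + s₀ = f σ = 1,
  -- and `latin-total` brings in k. Every transposition is counted twice, hence the doubled k and n.
  sensitivity : ∀ σ → P σ → ∑[ i < n ] ∑[ j < n ] sensitive σ i j + (k + k) ≡ n + n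
  sensitivity σ p = ℤ.+-injective (begin
    + E ℤ.+ (+ k ℤ.+ + k)
      ≡⟨ cong (λ z → + E ℤ.+ (z ℤ.+ z)) latin-total ⟩
    + E ℤ.+ ((+ n ℤ.* c₀ ℤ.+ total) ℤ.+ (+ n ℤ.* c₀ ℤ.+ total))
      ≡⟨ lemma₁ (+ E) (+ n) c₀ total ⟩
    (+ E ℤ.+ total ℤ.+ total) ℤ.+ (+ n ℤ.* c₀ ℤ.+ + n ℤ.* c₀)
      ≡⟨ cong (ℤ._+ (+ n ℤ.* c₀ ℤ.+ + n ℤ.* c₀)) summed ⟨
    (+ n ℤ.* s₀ ℤ.+ + n ℤ.* s₀) ℤ.+ (+ n ℤ.* c₀ ℤ.+ + n ℤ.* c₀)
      ≡⟨ lemma₂ (+ n) s₀ c₀ ⟩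
    + n ℤ.* (c₀ ℤ.+ s₀) ℤ.+ + n ℤ.* (c₀ ℤ.+ s₀)
      ≡⟨ cong (λ z → + n ℤ.* z ℤ.+ + n ℤ.* z) (trans (sym (f-degree-one σ)) (f-true p)) ⟩
    + n ℤ.* + 1 ℤ.+ + n ℤ.* + 1
      ≡⟨ cong (λ z → z ℤ.+ z) (ℤ.*-identityʳ (+ n)) ⟩
    + n ℤ.+ + n ∎)
    where
    open ≡-Reasoning
    E = ∑[ i < n ] ∑[ j < n ] sensitive σ i j
    s₀ = sumℤ (λ i → b i (σ ⟨$⟩ʳ i))
    lemma₁ : ∀ e n c t → e ℤ.+ ((n ℤ.* c ℤ.+ t) ℤ.+ (n ℤ.* c ℤ.+ t)) ≡ (e ℤ.+ t ℤ.+ t) ℤ.+ (n ℤ.* c ℤ.+ n ℤ.* c)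
    lemma₁ = solve-∀
    lemma₂ : ∀ n s c → (n ℤ.* s ℤ.+ n ℤ.* s) ℤ.+ (n ℤ.* c ℤ.+ n ℤ.* c) ≡ n ℤ.* (c ℤ.+ s) ℤ.+ n ℤ.* (c ℤ.+ s)
    lemma₂ = solve-∀
    lemma₃ : ∀ e g u v w z → e ℤ.+ g ≡ + 1 → g ℤ.- + 1 ≡ u ℤ.+ v ℤ.- w ℤ.- z → w ℤ.+ z ≡ e ℤ.+ u ℤ.+ v
    lemma₃ e g u v w z h h′ = begin
      w ℤ.+ z                                                 ≡⟨ l₁ u v w z ⟩
      u ℤ.+ v ℤ.- (u ℤ.+ v ℤ.- w ℤ.- z)                       ≡⟨ cong (λ y → u ℤ.+ v ℤ.- y) h′ ⟨
      u ℤ.+ v ℤ.- (g ℤ.- + 1)                                 ≡⟨ cong (λ y → u ℤ.+ v ℤ.- (g ℤ.- y)) h ⟨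
      u ℤ.+ v ℤ.- (g ℤ.- (e ℤ.+ g))                           ≡⟨ l₂ u v g e ⟩
      e ℤ.+ u ℤ.+ v                                           ∎
      where
      l₁ : ∀ u v w z → w ℤ.+ z ≡ u ℤ.+ v ℤ.- (u ℤ.+ v ℤ.- w ℤ.- z)
      l₁ = solve-∀
      l₂ : ∀ u v g e → u ℤ.+ v ℤ.- (g ℤ.- (e ℤ.+ g)) ≡ e ℤ.+ u ℤ.+ v
      l₂ = solve-∀
    A : Fin n → ℤ
    A i = b i (σ ⟨$⟩ʳ i)
    pointwise : ∀ i j → A i ℤ.+ A j ≡ + sensitive σ i j ℤ.+ b i (σ ⟨$⟩ʳ j) ℤ.+ b j (σ ⟨$⟩ʳ i)
    pointwise i j = lemma₃ (+ sensitive σ i j) (f (sw i j σ)) (b i (σ ⟨$⟩ʳ j)) (b j (σ ⟨$⟩ʳ i)) (A i) (A j) (sensitive+f σ i j)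
      (trans (cong (ℤ._-_ (f (sw i j σ))) (sym (f-true p)))
        (trans (sym (D-eq i j σ refl refl)) (D-b i j (σ ⟨$⟩ʳ i) (σ ⟨$⟩ʳ j))))
    total-σ : sumℤ (λ i → sumℤ (λ j → b i (σ ⟨$⟩ʳ j))) ≡ total
    total-σ = sym (sumℤ-cong λ i → sumℤ-permute (b i) σ)
    sumℤ₂-+ : ∀ (g h : Fin n → Fin n → ℤ) →
      sumℤ (λ i → sumℤ (λ j → g i j ℤ.+ h i j)) ≡ sumℤ (λ i → sumℤ (g i)) ℤ.+ sumℤ (λ i → sumℤ (h i))
    sumℤ₂-+ g h = trans (sumℤ-cong λ i → sumℤ-+ (g i) (h i)) (sumℤ-+ (λ i → sumℤ (g i)) (λ i → sumℤ (h i)))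
    diagonal : sumℤ (λ (i : Fin n) → sumℤ (λ j → A j)) ≡ + n ℤ.* s₀
    diagonal = sumℤ-const n s₀
    summed : + n ℤ.* s₀ ℤ.+ + n ℤ.* s₀ ≡ + E ℤ.+ total ℤ.+ total
    summed = begin
      + n ℤ.* s₀ ℤ.+ + n ℤ.* s₀
        ≡⟨ cong₂ ℤ._+_ (trans (sumℤ-comm (λ i (j : Fin n) → A i)) diagonal) diagonal ⟨
      sumℤ (λ i → sumℤ (λ (j : Fin n) → A i)) ℤ.+ sumℤ (λ (i : Fin n) → sumℤ (λ j → A j))
        ≡⟨ sumℤ₂-+ (λ i j → A i) (λ i j → A j) ⟨
      sumℤ (λ i → sumℤ (λ j → A i ℤ.+ A j))
        ≡⟨ sumℤ-cong (λ i → sumℤ-cong (pointwise i)) ⟩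
      sumℤ (λ i → sumℤ (λ j → + sensitive σ i j ℤ.+ b i (σ ⟨$⟩ʳ j) ℤ.+ b j (σ ⟨$⟩ʳ i)))
        ≡⟨ sumℤ₂-+ (λ i j → + sensitive σ i j ℤ.+ b i (σ ⟨$⟩ʳ j)) (λ i j → b j (σ ⟨$⟩ʳ i)) ⟩
      sumℤ (λ i → sumℤ (λ j → + sensitive σ i j ℤ.+ b i (σ ⟨$⟩ʳ j))) ℤ.+ sumℤ (λ i → sumℤ (λ j → b j (σ ⟨$⟩ʳ i)))
        ≡⟨ cong₂ ℤ._+_ (sumℤ₂-+ (λ i j → + sensitive σ i j) (λ i j → b i (σ ⟨$⟩ʳ j))) (sumℤ-comm (λ i j → b j (σ ⟨$⟩ʳ i))) ⟩
      sumℤ (λ i → sumℤ (λ j → + sensitive σ i j)) ℤ.+ sumℤ (λ i → sumℤ (λ j → b i (σ ⟨$⟩ʳ j))) ℤ.+ sumℤ (λ i → sumℤ (λ j → b i (σ ⟨$⟩ʳ j)))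
        ≡⟨ cong₂ ℤ._+_ (cong₂ ℤ._+_ (trans (sumℤ-cong (λ i → sumℤ-pos (sensitive σ i))) (sumℤ-pos (λ i → sum (sensitive σ i)))) total-σ) total-σ ⟩
      + E ℤ.+ total ℤ.+ total ∎

  sw⇒≢ : ∀ {σ i j} → ¬ (P σ → P (sw i j σ)) → i ≢ j
  sw⇒≢ {σ} {i} ¬pp refl = ¬pp (P-resp σ (sw i i σ) (sw-diag i σ))

  sw⇒≢′ : ∀ {σ i j} → ¬ (P (sw i j σ) → P σ) → i ≢ j
  sw⇒≢′ {σ} {i} ¬pp refl = ¬pp (P-resp (sw i i σ) σ (λ q → sym (sw-diag i σ q)))

  -- Otherwise f would drop twice, from 1 to - 1.
  sensitive-meet⁺ : ∀ {σ i j p q} → P σ → ¬ P (sw i j σ) → ¬ P (sw p q σ) →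
    i ≢ p → i ≢ q → j ≢ p → ¬ (j ≢ q)
  sensitive-meet⁺ {σ} {i} {j} {p} {q} Pσ ¬ij ¬pq i≢p i≢q j≢p j≢q =
    contradiction (trans (sym (trans (cong (ℤ._-_ (f (sw i j (sw p q σ)))) (f-false ¬pq)) (ℤ.+-identityʳ (f (sw i j (sw p q σ))))))
      (trans (commuting-differences σ i j p q (i≢j , i≢p , i≢q , j≢p , j≢q , p≢q)) (cong₂ ℤ._-_ (f-false ¬ij) (f-true Pσ))))
      λ ()
    where
    i≢j = sw⇒≢ {σ} {i} {j} λ pp → ¬ij (pp Pσ)
    p≢q = sw⇒≢ {σ} {p} {q} λ pp → ¬pq (pp Pσ)

  -- Otherwise f would rise twice, from 0 to 2.
  sensitive-meet⁻ : ∀ {σ i j p q} → ¬ P σ → P (sw i j σ) → P (sw p q σ) →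
    i ≢ p → i ≢ q → j ≢ p → ¬ (j ≢ q)
  sensitive-meet⁻ {σ} {i} {j} {p} {q} ¬Pσ Pij Ppq i≢p i≢q j≢p j≢q =
    f-1≢1 (sw i j (sw p q σ)) (trans (cong (ℤ._-_ (f (sw i j (sw p q σ)))) (sym (f-true Ppq)))
      (trans (commuting-differences σ i j p q (i≢j , i≢p , i≢q , j≢p , j≢q , p≢q)) (cong₂ ℤ._-_ (f-true Pij) (f-false ¬Pσ))))
    where
    i≢j = sw⇒≢′ {σ} {i} {j} λ pp → ¬Pσ (pp Pij)
    p≢q = sw⇒≢′ {σ} {p} {q} λ pp → ¬Pσ (pp Ppq)
    f-1≢1 : ∀ τ → f τ ℤ.- + 1 ≢ + 1
    f-1≢1 τ with P? τ
    ... | yes _ = λ ()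
    ... | no _  = λ ()

  degree : Permutation′ n → Fin n → ℕ
  degree σ i = ∑[ j < n ] sensitive σ i j

  sensitive-sym : ∀ σ i j → sensitive σ i j ≡ sensitive σ j i
  sensitive-sym σ i j = ind-cong (¬? (P? (sw i j σ))) (¬? (P? (sw j i σ)))
    (_∘ P-resp (sw j i σ) (sw i j σ) (sw-sym i j σ)) (_∘ P-resp (sw i j σ) (sw j i σ) (sw-sym j i σ))

  -- By `sensitive-meet⁺` every sensitive pair shares a place with {i, j}. `T` charges it to row i
  -- or j, and the transpose of `T` to column i or j.
  sensitivity≤ : ∀ {σ i j} → P σ → ¬ P (sw i j σ) →
    ∑[ p < n ] ∑[ q < n ] sensitive σ p q ≤ (degree σ i + degree σ j) + (degree σ i + degree σ j)
  sensitivity≤ {σ} {i} {j} Pσ ¬ij = begin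
    ∑[ p < n ] ∑[ q < n ] sensitive σ p q
      ≤⟨ sum-mono (λ p → sum-mono (pointwise p)) ⟩
    ∑[ p < n ] ∑[ q < n ] (T p q + T q p)
      ≡⟨ sum-cong-≗ (λ p → ∑-distrib-+ (T p) (λ q → T q p)) ⟩
    ∑[ p < n ] (∑[ q < n ] T p q + ∑[ q < n ] T q p)
      ≡⟨ ∑-distrib-+ (λ p → ∑[ q < n ] T p q) (λ p → ∑[ q < n ] T q p) ⟩
    ∑[ p < n ] ∑[ q < n ] T p q + ∑[ p < n ] ∑[ q < n ] T q p
      ≡⟨ cong₂ _+_ sum-T (trans (∑-comm (λ p q → T q p)) sum-T) ⟩
    (degree σ i + degree σ j) + (degree σ i + degree σ j) ∎
    where
    open ℕ.≤-Reasoning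
    row : Fin n → Fin n → Fin n → ℕ
    row r p q = ind (p ≟ r) * sensitive σ r q
    T : Fin n → Fin n → ℕ
    T p q = row i p q + row j p q
    sum-row : ∀ r → ∑[ p < n ] ∑[ q < n ] row r p q ≡ degree σ r
    sum-row r = trans (sum-cong-≗ λ p → sym (*-distribˡ-sum (ind (p ≟ r)) (sensitive σ r)))
      (trans (sym (*-distribʳ-sum (degree σ r) (λ p → ind (p ≟ r))))
        (trans (cong (_* degree σ r) (∑-δ r)) (ℕ.*-identityˡ (degree σ r))))
    sum-T : ∑[ p < n ] ∑[ q < n ] T p q ≡ degree σ i + degree σ j
    sum-T = trans (sum-cong-≗ λ p → ∑-distrib-+ (row i p) (row j p))
      (trans (∑-distrib-+ (λ p → sum (row i p)) (λ p → sum (row j p))) (cong₂ _+_ (sum-row i) (sum-row j)))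
    in-row : ∀ r q → sensitive σ r q ≤ row r r q
    in-row r q = ≤-reflexive (sym (trans (cong (_* sensitive σ r q) (ind-true (r ≟ r) refl)) (ℕ.*-identityˡ _)))
    cases : ∀ p q → (p ≡ i ⊎ p ≡ j) ⊎ (q ≡ i ⊎ q ≡ j) ⊎ (i ≢ p × i ≢ q × j ≢ p × j ≢ q)
    cases p q with p ≟ i | p ≟ j | q ≟ i | q ≟ j
    ... | yes e | _ | _ | _ = inj₁ (inj₁ e)
    ... | no _ | yes e | _ | _ = inj₁ (inj₂ e)
    ... | no _ | no _ | yes e | _ = inj₂ (inj₁ (inj₁ e))
    ... | no _ | no _ | no _ | yes e = inj₂ (inj₁ (inj₂ e))
    ... | no p≢i | no p≢j | no q≢i | no q≢j = inj₂ (inj₂ (p≢i ∘ sym , q≢i ∘ sym , p≢j ∘ sym , q≢j ∘ sym))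
    in-T : ∀ r q → r ≡ i ⊎ r ≡ j → sensitive σ r q ≤ T r q
    in-T r q (inj₁ refl) = ≤-trans (in-row i q) (m≤m+n _ (row j r q))
    in-T r q (inj₂ refl) = ≤-trans (in-row j q) (m≤n+m _ (row i r q))
    pointwise : ∀ p q → sensitive σ p q ≤ T p q + T q p
    pointwise p q with cases p q
    ... | inj₁ c = ≤-trans (in-T p q c) (m≤m+n (T p q) (T q p))
    ... | inj₂ (inj₁ c) = ≤-trans (≤-reflexive (sensitive-sym σ p q)) (≤-trans (in-T q p c) (m≤n+m (T q p) (T p q)))
    ... | inj₂ (inj₂ (i≢p , i≢q , j≢p , j≢q)) = ≤-trans (≤-reflexive
      (ind-false (¬? (P? (sw p q σ))) λ ¬pq → sensitive-meet⁺ Pσ ¬ij ¬pq i≢p i≢q j≢p j≢q)) z≤n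

  -- There are 2 (n - k) ≥ 14 ordered sensitive pairs. If both ends of one of them had degree at
  -- most 3, `sensitivity≤` would allow only 12.
  high-degree : ∀ σ → P σ → 7 + k ≤ n → ∃ λ i → 4 ≤ degree σ i
  high-degree σ Pσ 7+k≤n with any? (λ i → any? λ j → ¬? (P? (sw i j σ)))
  ... | no none = contradiction (≤-trans (≤-reflexive (sym (sensitivity σ Pσ))) (≤-reflexive (cong (_+ (k + k)) vanish)))
                    (ℕ.<⇒≱ (ℕ.+-mono-< k<n k<n))
    where
    k<n : k < n
    k<n = ≤-trans (m≤n+m (suc k) 6) (≤-trans (≤-reflexive (ℕ.+-suc 6 k)) 7+k≤n)
    vanish : ∑[ p < n ] ∑[ q < n ] sensitive σ p q ≡ 0
    vanish = sum-zero λ p → sum-zero λ q → ind-false (¬? (P? (sw p q σ))) λ ¬pq → none (p , q , ¬pq)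
  ... | yes (i , j , ¬ij) with 4 ≤? degree σ i | 4 ≤? degree σ j
  ...   | yes 4≤ | _ = i , 4≤
  ...   | no _ | yes 4≤ = j , 4≤
  ...   | no 4≰i | no 4≰j = contradiction (begin
      suc (n + n)                                          ≡⟨ cong suc (sensitivity σ Pσ) ⟨
      suc (∑[ p < n ] ∑[ q < n ] sensitive σ p q + (k + k))
        ≤⟨ s≤s (ℕ.+-monoˡ-≤ (k + k) (≤-trans (sensitivity≤ Pσ ¬ij) (+-mono-≤ both both))) ⟩
      suc ((3 + 3) + (3 + 3) + (k + k))                    ≤⟨ ℕ.n≤1+n _ ⟩
      14 + (k + k)                                         ≡⟨ lemma k ⟩
      (7 + k) + (7 + k)                                    ≤⟨ +-mono-≤ 7+k≤n 7+k≤n ⟩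
      n + n                                                ∎) ℕ.1+n≰n
    where
    open ℕ.≤-Reasoning
    both : degree σ i + degree σ j ≤ 3 + 3
    both = +-mono-≤ (ℕ.≤-pred (ℕ.≰⇒> 4≰i)) (ℕ.≤-pred (ℕ.≰⇒> 4≰j))
    lemma : ∀ k → 14 + (k + k) ≡ (7 + k) + (7 + k)
    lemma = ℕ-Solver.solve-∀

  -- By `Δ-local` the switch lowers f by one at τ as well, which is impossible from 0.
  sensitive-local : ∀ {σ i j} → P σ → ¬ P (sw i j σ) → ∀ τ → τ ⟨$⟩ʳ i ≡ σ ⟨$⟩ʳ i → τ ⟨$⟩ʳ j ≡ σ ⟨$⟩ʳ j → P τ
  sensitive-local {σ} {i} {j} Pσ ¬ij τ eᵢ eⱼ with P? τ
  ... | yes Pτ = Pτ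
  ... | no ¬Pτ = contradiction (trans (sym (ℤ.+-identityʳ (f (sw i j τ)))) (trans (sym (cong (ℤ._-_ (f (sw i j τ))) (f-false ¬Pτ)))
      (trans (Δ-local (sw⇒≢ {σ} {i} {j} λ pp → ¬ij (pp Pσ)) τ σ eᵢ eⱼ) (cong₂ ℤ._-_ (f-false ¬ij) (f-true Pσ)))))
      λ ()

  -- If τ ∉ P, every leaf j of i at σ yields the sensitive pair {j , τ⁻¹ (σ j)} at τ.
  -- These pairs meet each other, which leaves room for at most three leaves.
  dictator : ∀ {σ i} → P σ → 4 ≤ degree σ i → ∀ τ → τ ⟨$⟩ʳ i ≡ σ ⟨$⟩ʳ i → P τ
  dictator {σ} {i} Pσ 4≤ τ eᵢ with P? τ
  ... | yes Pτ = Pτ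
  ... | no ¬Pτ with any? (λ j → ¬? (P? (sw i j σ)))
  ...   | no none = contradiction (≤-trans 4≤ (≤-reflexive (sum-zero λ j → ind-false (¬? (P? (sw i j σ))) λ ¬j → none (j , ¬j)))) λ ()
  ...   | yes (j₁ , leaf₁) = contradiction (≤-trans 4≤ (begin
      degree σ i
        ≤⟨ sum-mono pointwise ⟩
      ∑[ j < n ] (ind (j ≟ j₁) + ind (j ≟ g j₁) + ind (j ≟ g⁻¹ j₁))
        ≡⟨ ∑-distrib-+ (λ j → ind (j ≟ j₁) + ind (j ≟ g j₁)) (λ j → ind (j ≟ g⁻¹ j₁)) ⟩
      ∑[ j < n ] (ind (j ≟ j₁) + ind (j ≟ g j₁)) + ∑[ j < n ] ind (j ≟ g⁻¹ j₁)
        ≡⟨ cong₂ _+_ (trans (∑-distrib-+ (λ j → ind (j ≟ j₁)) (λ j → ind (j ≟ g j₁))) (cong₂ _+_ (∑-δ j₁) (∑-δ (g j₁)))) (∑-δ (g⁻¹ j₁)) ⟩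
      3 ∎)) ℕ.1+n≰n
    where
    open ℕ.≤-Reasoning
    Leaf : Fin n → Set
    Leaf j = ¬ P (sw i j σ)
    g g⁻¹ : Fin n → Fin n
    g j = τ ⟨$⟩ˡ (σ ⟨$⟩ʳ j)
    g⁻¹ j = σ ⟨$⟩ˡ (τ ⟨$⟩ʳ j)
    g⁻¹-g : ∀ j → g⁻¹ (g j) ≡ j
    g⁻¹-g j = trans (cong (σ ⟨$⟩ˡ_) (inverseʳ τ)) (inverseˡ σ)
    pair : ∀ j → Leaf j → P (sw j (g j) τ)
    pair j leaf = sensitive-local Pσ leaf (sw j (g j) τ) at-i (trans (sw-left j (g j) τ) (inverseʳ τ))
      where
      i≢j : i ≢ j
      i≢j = sw⇒≢ {σ} {i} {j} λ pp → leaf (pp Pσ)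
      i≢gj : i ≢ g j
      i≢gj e = i≢j (perm-injective σ (trans (sym eᵢ) (trans (cong (τ ⟨$⟩ʳ_) e) (inverseʳ τ))))
      at-i : sw j (g j) τ ⟨$⟩ʳ i ≡ σ ⟨$⟩ʳ i
      at-i = trans (sw-other j (g j) τ i≢j i≢gj) eᵢ
    -- The pairs (j, g j) and (j₁, g j₁) must share a place. As g is injective, g j = g j₁ falls
    -- under j = j₁, so three coincidences remain.
    near : ∀ j → Leaf j → j ≡ j₁ ⊎ j ≡ g j₁ ⊎ j ≡ g⁻¹ j₁
    near j leaf with j ≟ j₁ | j ≟ g j₁ | j ≟ g⁻¹ j₁
    ... | yes e | _ | _ = inj₁ e
    ... | no _ | yes e | _ = inj₂ (inj₁ e)
    ... | no _ | no _ | yes e = inj₂ (inj₂ e)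
    ... | no j≢j₁ | no j≢gj₁ | no j≢g⁻¹j₁ = contradiction gj≢gj₁
      (sensitive-meet⁻ ¬Pτ (pair j leaf) (pair j₁ leaf₁) j≢j₁ j≢gj₁ gj≢j₁)
      where
      gj≢j₁ : g j ≢ j₁
      gj≢j₁ e = j≢g⁻¹j₁ (trans (sym (g⁻¹-g j)) (cong g⁻¹ e))
      gj≢gj₁ : g j ≢ g j₁
      gj≢gj₁ e = j≢j₁ (trans (sym (g⁻¹-g j)) (trans (cong g⁻¹ e) (g⁻¹-g j₁)))
    pointwise : ∀ j → sensitive σ i j ≤ ind (j ≟ j₁) + ind (j ≟ g j₁) + ind (j ≟ g⁻¹ j₁)
    pointwise j with P? (sw i j σ)
    ... | yes _ = z≤n
    ... | no leaf with near j leaf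
    ...   | inj₁ e = ≤-trans (≤-reflexive (sym (ind-true (j ≟ j₁) e))) (≤-trans (m≤m+n _ _) (m≤m+n _ _))
    ...   | inj₂ (inj₁ e) = ≤-trans (≤-reflexive (sym (ind-true (j ≟ g j₁) e))) (≤-trans (m≤n+m _ (ind (j ≟ j₁))) (m≤m+n _ _))
    ...   | inj₂ (inj₂ e) = ≤-trans (≤-reflexive (sym (ind-true (j ≟ g⁻¹ j₁) e))) (m≤n+m _ _)

-- Splitting off cells

-- Every Latin square has exactly one row through the cell (x, y), and this row was counted because
-- the whole set lies in P.
without-cell : ∀ {n k} (B : Balanced n (suc k)) (x y : Fin n) →
  (∀ σ → Σ[ x , y ] σ → Balanced.P B σ) → Balanced n k
without-cell {n} {k} B x y Σ⊆P = record
  { P        = λ σ → P σ × ¬ Σ[ x , y ] σ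
  ; P?       = P′?
  ; P-resp   = λ { σ τ e (p , q) → P-resp σ τ e p , λ q′ → q (trans (e x) q′) }
  ; balanced = balanced′
  }
  where
  open Balanced B
  P′? : ∀ σ → Dec (P σ × ¬ Σ[ x , y ] σ)
  P′? σ = P? σ ×-dec ¬? ((σ ⟨$⟩ʳ x) ≟ y)
  once : ∀ ℓ → IsLatin ℓ → ∑[ t < n ] ind ((ℓ t ⟨$⟩ʳ x) ≟ y) ≡ 1
  once ℓ L = sum-ind-unique (λ t → (ℓ t ⟨$⟩ʳ x) ≟ y) (column ⟨$⟩ˡ y) (inverseʳ column)
    λ t e → trans (sym (inverseˡ column)) (cong (column ⟨$⟩ˡ_) e)
    where column = latin-column ℓ L x
  split : ∀ σ → ind (P′? σ) + ind ((σ ⟨$⟩ʳ x) ≟ y) ≡ ind (P? σ)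
  split σ with P? σ | (σ ⟨$⟩ʳ x) ≟ y
  ... | yes _ | yes _ = refl
  ... | yes _ | no _  = refl
  ... | no ¬p | yes e = contradiction (Σ⊆P σ e) ¬p
  ... | no _  | no _  = refl
  balanced′ : ∀ ℓ → IsLatin ℓ → ∑[ t < n ] ind (P′? (ℓ t)) ≡ k
  balanced′ ℓ L = ℕ.+-cancelʳ-≡ 1 _ _ (begin
    ∑[ t < n ] ind (P′? (ℓ t)) + 1
      ≡⟨ cong (λ z → ∑[ t < n ] ind (P′? (ℓ t)) + z) (once ℓ L) ⟨
    ∑[ t < n ] ind (P′? (ℓ t)) + ∑[ t < n ] ind ((ℓ t ⟨$⟩ʳ x) ≟ y)
      ≡⟨ ∑-distrib-+ (λ t → ind (P′? (ℓ t))) (λ t → ind ((ℓ t ⟨$⟩ʳ x) ≟ y)) ⟨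
    ∑[ t < n ] (ind (P′? (ℓ t)) + ind ((ℓ t ⟨$⟩ʳ x) ≟ y))
      ≡⟨ sum-cong-≗ (λ t → split (ℓ t)) ⟩
    ∑[ t < n ] ind (P? (ℓ t))
      ≡⟨ balanced ℓ L ⟩
    suc k
      ≡⟨ ℕ.+-comm 1 k ⟩
    k + 1 ∎)
    where open ≡-Reasoning

record Partition {n} (P : Permutation′ n → Set) (k : ℕ) : Set where
  field
    row col : Fin k → Fin n
    covers  : ∀ σ → P σ → ∃ λ t → Σ[ row t , col t ] σ
    inside  : ∀ σ t → Σ[ row t , col t ] σ → P σ
    once    : ∀ σ s t → Σ[ row s , col s ] σ → Σ[ row t , col t ] σ → s ≡ t

add-cell : ∀ {n k} (B : Balanced n (suc k)) (x y : Fin n) (Σ⊆P : ∀ σ → Σ[ x , y ] σ → Balanced.P B σ) →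
  Partition (Balanced.P (without-cell B x y Σ⊆P)) k → Partition (Balanced.P B) (suc k)
add-cell {k = k} B x y Σ⊆P p = record
  { row    = row′
  ; col    = col′
  ; covers = covers′
  ; inside = λ { τ zero e → Σ⊆P τ e ; τ (suc t) e → proj₁ (inside τ t e) }
  ; once   = λ { τ zero zero _ _ → refl
               ; τ zero (suc t) e e′ → contradiction e (proj₂ (inside τ t e′))
               ; τ (suc s) zero e e′ → contradiction e′ (proj₂ (inside τ s e))
               ; τ (suc s) (suc t) e e′ → cong suc (once τ s t e e′) }
  }
  where
  open Partition p
  row′ = Vector._∷_ x row
  col′ = Vector._∷_ y col
  covers′ : ∀ τ → Balanced.P B τ → ∃ λ t → Σ[ row′ t , col′ t ] τ
  covers′ τ Pτ with (τ ⟨$⟩ʳ x) ≟ y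
  ... | yes e = zero , e
  ... | no ¬e with t , e ← covers τ (Pτ , ¬e) = suc t , e

-- For k = 0, renaming symbols turns row 0 of the seed square into any given σ, so a single member
-- of P would spoil the count. For larger k the seed square itself shows that P is inhabited.
partition : ∀ {n′} → Seed n′ → ∀ k → 7 + k ≤ 4 + n′ → (B : Balanced (4 + n′) k) → Partition (Balanced.P B) k
partition {n′} S zero _ B = record
  { row = λ () ; col = λ () ; covers = λ σ p → contradiction p (empty σ) ; inside = λ _ () ; once = λ _ () }
  where
  open Balanced B
  open Seed S
  translate : Permutation′ (4 + n′) → Fin (4 + n′) → Permutation′ (4 + n′)
  translate σ t = square t ∘ₚ flip (square 0F) ∘ₚ σ
  empty : ∀ σ → ¬ P σ
  empty σ p = contradiction (≤-trans (≤-reflexive (sym (ind-true (P? (translate σ 0F)) p′)))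
    (≤-trans (ℕ.m≤m+n _ _) (≤-reflexive (balanced (translate σ)
      λ { s≢t (i , e) → latin s≢t (i , perm-injective (flip (square 0F) ∘ₚ σ) e) })))) λ ()
    where
    p′ : P (translate σ 0F)
    p′ = P-resp σ (translate σ 0F) (λ i → cong (σ ⟨$⟩ʳ_) (sym (inverseˡ (square 0F)))) p
partition {n′} S (suc k) k≤ B = go nonempty
  where
  open Balanced B
  open Seed S
  open Dictator S B
  nonempty : ∃ P
  nonempty with any? (λ t → P? (square t))
  ... | yes (t , p) = square t , p
  ... | no none = contradiction (trans (sym (balanced square latin))
      (sum-zero λ t → ind-false (P? (square t)) λ p → none (t , p))) λ ()
  go : ∃ P → Partition P (suc k)
  go (σ , Pσ) with i , 4≤ ← high-degree σ Pσ k≤ = add-cell B i (σ ⟨$⟩ʳ i) (dictator Pσ 4≤)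
    (partition S k (≤-trans (ℕ.n≤1+n _) k≤) (without-cell B i (σ ⟨$⟩ʳ i) (dictator Pσ 4≤)))

-- Cells on a common line

Collinear : ∀ {k n} → (Fin k → Fin n) → (Fin k → Fin n) → Set
Collinear u v = (∀ s t → u s ≡ u t) × Injective _≡_ _≡_ v

module _ {n k} {P : Permutation′ n → Set} (p : Partition P (suc k)) where
  open Partition p

  same-cell : ∀ s t → row s ≡ row t → col s ≡ col t → s ≡ t
  same-cell s t r c with σ , q ∷ [] ← extend ((row s , col s) ∷ []) ([] ∷ []) =
    once σ s t q (trans (cong (σ ⟨$⟩ʳ_) (sym r)) (trans q c))

  -- Two cells in different rows and different columns lie on a common permutation, which would be
  -- covered twice.
  same-line : ∀ s t → row s ≢ row t → col s ≡ col t
  same-line s t r≢ with col s ≟ col t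
  ... | yes c = c
  ... | no c≢ with σ , q ∷ q′ ∷ [] ← extend ((row s , col s) ∷ (row t , col t) ∷ []) (((r≢ , c≢) ∷ []) ∷ [] ∷ []) =
    contradiction (cong row (once σ s t q q′)) r≢

  -- If row t differs from row zero, every row differs from one of the two, and `same-line` carries
  -- the column of cell zero to each cell, through t if necessary.
  collinear : Collinear row col ⊎ Collinear col row
  collinear with any? (λ t → ¬? (row t ≟ row zero))
  ... | no none = inj₁ ((λ s t → row≡ s t) , λ {s} {t} → same-cell s t (row≡ s t))
    where
    row₀ : ∀ t → row t ≡ row zero
    row₀ t = decidable-stable (row t ≟ row zero) λ r → none (t , r)
    row≡ : ∀ s t → row s ≡ row t
    row≡ s t = trans (row₀ s) (sym (row₀ t))
  ... | yes (t , rₜ≢) = inj₂ ((λ s u → col≡ s u) , λ {s} {u} r → same-cell s u r (col≡ s u))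
    where
    col₀ : ∀ s → col s ≡ col zero
    col₀ s with row s ≟ row zero
    ... | no r≢ = same-line s zero r≢
    ... | yes r = trans (same-line s t λ r′ → rₜ≢ (trans (sym r′) r)) (same-line t zero rₜ≢)
    col≡ : ∀ s u → col s ≡ col u
    col≡ s u = trans (col₀ s) (sym (col₀ u))

-- The logarithmic bound and the theorem

-- Only the first term (n - 1) / n of the logarithm series is used.
log-bound : ∀ n s c .{{_ : NonZero c}} .{{_ : NonTrivial n}} → s ≤ n /[ c ·log n ] → s * c * (n ∸ 1) ≤ n * n
log-bound (suc (suc n)) s c s≤ = ℤ.drop‿+≤+ (subst₂ ℤ._≤_
    (trans (ℤ.*-identityʳ (+ (s * c) ℤ.* + suc n)) (sym (ℤ.pos-* (s * c) (suc n))))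
    (trans (cong (λ z → + N ℤ.* + z) (ℕ.*-identityˡ N)) (sym (ℤ.pos-* N N)))
    (ℚᵘ.drop-*≤* bound))
  where
  N = suc (suc n)
  q = + suc n ℚ./ N
  first-term : logSum N 1 ≡ q
  first-term = trans (ℚ.+-identityˡ _) (trans (ℚ.*-identityʳ _) (ℚ.*-identityʳ q))
  bound : mkℚᵘ (+ (s * c)) 0 *ᵘ mkℚᵘ (+ suc n) (suc n) ≤ᵘ mkℚᵘ (+ N) 0
  bound = begin
    mkℚᵘ (+ (s * c)) 0 *ᵘ mkℚᵘ (+ suc n) (suc n)
      ≃⟨ ℚᵘ.*-cong (ℚ.toℚᵘ-fromℚᵘ (mkℚᵘ (+ (s * c)) 0)) (ℚ.toℚᵘ-fromℚᵘ (mkℚᵘ (+ suc n) (suc n))) ⟨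
    ℚ.toℚᵘ (+ (s * c) ℚ./ 1) *ᵘ ℚ.toℚᵘ q
      ≃⟨ ℚ.toℚᵘ-homo-* (+ (s * c) ℚ./ 1) q ⟨
    ℚ.toℚᵘ ((+ (s * c) ℚ./ 1) ℚ.* q)
      ≤⟨ ℚ.toℚᵘ-mono-≤ (subst (λ z → (+ (s * c) ℚ./ 1) ℚ.* z ℚ.≤ + N ℚ./ 1) first-term (s≤ 1)) ⟩
    ℚ.toℚᵘ (+ N ℚ./ 1)
      ≃⟨ ℚ.toℚᵘ-fromℚᵘ (mkℚᵘ (+ N) 0) ⟩
    mkℚᵘ (+ N) 0 ∎
    where open ℚᵘ.≤-Reasoning

-- For n ≥ 2 the term (n - 1) / n is at least one half.
log-bound′ : ∀ n s c .{{_ : NonZero c}} .{{_ : NonTrivial n}} → s ≤ n /[ c ·log n ] → s * c ≤ 2 * n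
log-bound′ n@(suc (suc n₀)) s c s≤ = ℕ.*-cancelʳ-≤ (s * c) (2 * n) n (begin
  s * c * n                         ≤⟨ ℕ.*-monoʳ-≤ (s * c) n≤2[n-1] ⟩
  s * c * (2 * suc n₀)              ≡⟨ lemma (s * c) (suc n₀) ⟩
  2 * (s * c * suc n₀)              ≤⟨ ℕ.*-monoʳ-≤ 2 (log-bound n s c s≤) ⟩
  2 * (n * n)                       ≡⟨ ℕ.*-assoc 2 n n ⟨
  2 * n * n                         ∎)
  where
  open ℕ.≤-Reasoning
  n≤2[n-1] : n ≤ 2 * suc n₀
  n≤2[n-1] = s≤s (≤-trans (ℕ.m≤n+m (suc n₀) n₀) (≤-reflexive (cong (λ z → n₀ + suc z) (sym (ℕ.+-identityʳ n₀)))))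
  lemma : ∀ a b → a * (2 * b) ≡ 2 * (a * b)
  lemma = ℕ-Solver.solve-∀

-- The factor 2 of `log-bound′` is set against 2 ^ 4 = 2 * 8, a lower bound for 2 ^ 17.
s*8≤n : ∀ n s .{{_ : NonTrivial n}} → s ≤ n /[ 2 ^ 17 ·log n ] → s * 8 ≤ n
s*8≤n n s s≤ = ℕ.*-cancelˡ-≤ 2 (begin
  2 * (s * 8)    ≡⟨ lemma s ⟩
  s * 2 ^ 4      ≤⟨ ℕ.*-monoʳ-≤ s (ℕ.^-monoʳ-≤ 2 (ℕ.m≤m+n 4 13)) ⟩
  s * 2 ^ 17     ≤⟨ log-bound′ n s (2 ^ 17) s≤ ⟩
  2 * n          ∎)
  where
  open ℕ.≤-Reasoning
  lemma : ∀ s → 2 * (s * 8) ≡ s * 16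
  lemma = ℕ-Solver.solve-∀

IsLine : ∀ {n} → Family n → ℕ → Set
IsLine {n} F k =
  (∃ λ (x : Fin n) → ∃ λ (y : Fin k → Fin n) →
    Injective _≡_ _≡_ y × (_∈ F) ≐ ⋃ (Fin k) (λ i → Σ[ x , y i ])) ⊎
  (∃ λ (y : Fin n) → ∃ λ (x : Fin k → Fin n) →
    Injective _≡_ _≡_ x × (_∈ F) ≐ ⋃ (Fin k) (λ i → Σ[ x i , y ]))

partition⇒line : ∀ {n k} (F : Family n) → Partition (_∈ F) (suc k) → IsLine F (suc k)
partition⇒line F p with collinear p
... | inj₁ (row≡ , col-injective) = inj₁ (row zero , col , col-injective ,
      (λ {σ} σ∈F → let t , e = covers σ σ∈F in t , trans (cong (σ ⟨$⟩ʳ_) (row≡ zero t)) e) ,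
      λ {σ} (t , e) → inside σ t (trans (cong (σ ⟨$⟩ʳ_) (row≡ t zero)) e))
  where open Partition p
... | inj₂ (col≡ , row-injective) = inj₂ (col zero , row , row-injective ,
      (λ {σ} σ∈F → let t , e = covers σ σ∈F in t , trans e (col≡ t zero)) ,
      λ {σ} (t , e) → inside σ t (trans e (col≡ zero t)))
  where open Partition p

bound∧structure : ∀ n k → 7 ≤ n → suc k ≤ n → (F : Family (7 + n)) → ν F ≤ suc k →
  (∣ F ∣ ≤ suc k * (6 + n) !) × (∣ F ∣ ≡ suc k * (6 + n) ! → IsLine F (suc k))
bound∧structure n k 7≤n k<n F ν≤ = size-bound ν≤ square latin , λ ∣F∣≡ →
  partition⇒line F (partition S (suc k) (ℕ.+-monoʳ-≤ 7 k<n) record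
    { P = _∈ F ; P? = _∈? F ; P-resp = ∈-resp-≈ F ; balanced = extremal⇒balanced ν≤ ∣F∣≡ })
  where
  S = seed n 7≤n
  open Seed S
  open Counting F

-- Let N = n - 7, as the seed has order 7 + N. From 7 s ≤ n follows N ≥ 7 (s - 1), hence N ≥ 7, as
-- `seed` demands, and N ≥ s - 1, the room that `high-degree` demands.
bound∧structure′ : ∀ n s → 2 ≤ s → s * 8 ≤ n → (F : Family n) → ν F < s →
  (∣ F ∣ ≤ (s ∸ 1) * (n ∸ 1) !) × (∣ F ∣ ≡ (s ∸ 1) * (n ∸ 1) ! → IsLine F (s ∸ 1))
bound∧structure′ n s@(suc (suc k)) (s≤s (s≤s z≤n)) 8s≤n F (s≤s ν≤) =
  go n (n ∸ 7) (sym (ℕ.m+[n∸m]≡n 7≤n)) F ν≤ 7≤N k≤N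
  where
  7s≤n : s * 7 ≤ n
  7s≤n = ≤-trans (ℕ.*-monoʳ-≤ s (ℕ.n≤1+n 7)) 8s≤n
  7≤n : 7 ≤ n
  7≤n = ≤-trans (m≤m+n 7 (suc k * 7)) 7s≤n
  7k≤N : suc k * 7 ≤ n ∸ 7
  7k≤N = ℕ.m+n≤o⇒m≤o∸n (suc k * 7) (≤-trans (≤-reflexive (ℕ.+-comm (suc k * 7) 7)) 7s≤n)
  7≤N : 7 ≤ n ∸ 7
  7≤N = ≤-trans (m≤m+n 7 (k * 7)) 7k≤N
  k≤N : suc k ≤ n ∸ 7
  k≤N = ≤-trans (ℕ.m≤m*n (suc k) 7) 7k≤N
  go : ∀ n N → n ≡ 7 + N → (F : Family n) → ν F ≤ suc k → 7 ≤ N → suc k ≤ N →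
    (∣ F ∣ ≤ suc k * (n ∸ 1) !) × (∣ F ∣ ≡ suc k * (n ∸ 1) ! → IsLine F (suc k))
  go _ N refl F ν≤ 7≤N k≤N = bound∧structure N k 7≤N k≤N F ν≤

theorem4 : (n s : ℕ) .{{_ : NonTrivial n}} → 2 ≤ s → s ≤ n /[ 2 ^ 17 ·log n ] →
    (F : Family n) → ν F < s →
    (∣ F ∣ ≤ (s ∸ 1) * (n ∸ 1) !) ×
    (∣ F ∣ ≡ (s ∸ 1) * (n ∸ 1) ! →
    (∃ λ (x : Fin n) → ∃ λ (y : Fin (s ∸ 1) → Fin n) →
    Injective _≡_ _≡_ y × (_∈ F) ≐ ⋃ (Fin (s ∸ 1)) (λ i → Σ[ x , y i ])) ⊎
    (∃ λ (y : Fin n) → ∃ λ (x : Fin (s ∸ 1) → Fin n) →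
    Injective _≡_ _≡_ x × (_∈ F) ≐ ⋃ (Fin (s ∸ 1)) (λ i → Σ[ x i , y ])))
theorem4 n s 2≤s s≤ F ν<s = bound∧structure′ n s 2≤s (s*8≤n n s s≤) F ν<s
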